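{- There exists an absolute constant $M>0$ such that for every prime $p$ and every proper subgroup $G$ of the multiplicative group $\mathbb{F}_p^*$ with $|G|>M$, there are no sets $A,B,C\subset\mathbb{F}_p$ with $|A|,|B|,|C|\ge2$ and $G=A+B+C$.
   Context: $\mathbb{F}_p$ is the field with $p$ elements. $A+B+C=\{a+b+c:a\in A,b\in B,c\in C\}$. -}

module Defs where

open import Data.Nat using (ℕ; zero; suc; _+_; _*_; NonZero)
open import Data.Nat.DivMod using (_mod_)
open import Data.Fin using (Fin; toℕ)
open import Data.Fin.Subset using (Subset; _∈_; _∉_)
open import Data.Product using (Σ; ∃; _×_; _,_)
open import Relation.Binary.PropositionalEquality using (_≡_; _≢_)
open import Relation.Nullary using (¬_)
open import Function.Bundles using (_⇔_)

-- The field 𝔽_p is modelled by Fin p = {0,…,p-1} with arithmetic mod p.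
module _ {p : ℕ} .{{_ : NonZero p}} where

  0F : Fin p
  0F = 0 mod p

  1F : Fin p
  1F = 1 mod p

  _+F_ : Fin p → Fin p → Fin p
  a +F b = (toℕ a + toℕ b) mod p

  _*F_ : Fin p → Fin p → Fin p
  a *F b = (toℕ a * toℕ b) mod p

  record IsSubgroupOfUnits (G : Subset p) : Set where
    field
      zero∉ : 0F ∉ G
      one∈  : 1F ∈ G
      mul∈  : ∀ x y → x ∈ G → y ∈ G → (x *F y) ∈ G
      inv∈  : ∀ x → x ∈ G → ∃ λ y → y ∈ G × (x *F y) ≡ 1F

  IsProperInUnits : Subset p → Set
  IsProperInUnits G = ∃ λ x → x ≢ 0F × x ∉ G

  IsSumset3 : Subset p → Subset p → Subset p → Subset p → Set
  IsSumset3 G A B C =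
    ∀ x → (x ∈ G) ⇔ (∃ λ a → ∃ λ b → ∃ λ c →
             a ∈ A × b ∈ B × c ∈ C × x ≡ ((a +F b) +F c))

{-# OPTIONS --safe #-}
module Submission where

-- Stepanov's method in the form of Hanson and Petridis, in its equality case. Let E and S be sets of
-- sizes m and n such that (s - e) ^ d = η for all s ∈ S and e ∈ E. With h_j the complete homogeneous
-- symmetric polynomial, f(x) = h_d (x - e : e ∈ E) - η has degree at most d and vanishes to order
-- exactly m at every s ∈ S, so mn ≤ d. If mn = d, then f is a constant multiple of ∏ (x - s) ^ m, and
-- comparing the next Taylor coefficient at s gives the electrostatic equations
--   (d - 1) ∑_e 1 / (s - e) = m (m + 1) ∑_{s′ ≠ s} 1 / (s - s′),
-- together with the same equations for E and S exchanged.
--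
-- Now let the differences s - e run through a subgroup G of order d, so that ∑ (s - e) ^ k = 0 for
-- 0 < k < d. Translate E and S so that ∑ e = 0 and let k be least such that the k-th power sums of E
-- and S do not both vanish. Multiplying the equations by s ^ (k + 1) and e ^ (k + 1) and adding
-- them up gives (k - 1) (m + n + 2) = 0 or (k + 3) (m - n) = 0 in the field. Hence m = n.
--
-- If G = A + B + C, this applies to A and B + C and to B and A + C. It follows that
-- |A|² = |G| = |B|² and |B + C| = |A| = |B|, which is impossible as |C| ≥ 2.

open import Defs
open import Level using (0ℓ)
open import Algebra.Core using (Op₁; Op₂)
open import Algebra.Bundles using (CommutativeRing)
open import Algebra.Definitions using (Associative; Commutative; LeftIdentity; _DistributesOverˡ_)
open import Algebra.Structures using (IsCommutativeRing)
import Algebra.Properties.AbelianGroup as AbelianGroupProperties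
import Algebra.Properties.CommutativeSemiring.Exp as Exponentiation
import Algebra.Properties.Ring as RingProperties
import Algebra.Properties.Semiring.Mult.TCOptimised as Multiples
import Algebra.Solver.Ring as RingSolver
open import Algebra.Solver.Ring.AlmostCommutativeRing using (AlmostCommutativeRing; fromCommutativeRing; _-Raw-AlmostCommutative⟶_)
open import Data.Bool using (true; false)
open import Data.Fin as Fin using (Fin; toℕ)
import Data.Fin.Properties as Finₚ
open import Data.Fin.Subset as Subset using (Subset; ∣_∣)
open import Data.Integer as ℤ using (ℤ; -[1+_]) renaming (+_ to pos)
import Data.Integer.Properties as ℤₚ
open import Data.List using (List; []; _∷_; _++_; cartesianProductWith; deduplicate; length; map)
open import Data.List.Properties using (length-map; length-++; length-tabulate; ++-identityʳ)
open import Data.List.Membership.Propositional using (_∈_; _∉_; find)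
open import Data.List.Membership.Propositional.Properties
  using (∈-map⁺; ∈-map⁻; ∈-allFin; ∈-∃++; ∈-cartesianProductWith⁺; ∈-cartesianProductWith⁻; ∈-deduplicate⁺; ∈-deduplicate⁻)
open import Data.List.Relation.Unary.All as All using (All; []; _∷_)
import Data.List.Relation.Unary.All.Properties as Allₚ
open import Data.List.Relation.Unary.AllPairs as AllPairs using ([]; _∷_)
open import Data.List.Relation.Unary.Any using (here; there)
open import Data.List.Relation.Unary.Unique.Propositional using (Unique)
import Data.List.Relation.Unary.Unique.Propositional.Properties as Uniqueₚ
import Data.List.Relation.Unary.Unique.DecPropositional.Properties as DecUniqueₚ
open import Data.List.Relation.Binary.Permutation.Propositional using (_↭_; refl; prep; swap; trans; ↭⇒↭ₛ; ↭-sym)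
open import Data.List.Relation.Binary.Permutation.Propositional.Properties using (∈-resp-↭; ↭-length; shift)
import Data.List.Relation.Binary.Permutation.Setoid.Properties as Permutationₛ
open import Data.Maybe using (Maybe; just; nothing)
open import Data.Nat as ℕ using (ℕ; zero; suc; NonZero; z≤n; s≤s; _∸_; _≤_; _<_)
import Data.Nat.Properties as ℕₚ
open import Data.Nat.Combinatorics using (nCk+nC[k+1]≡[n+1]C[k+1]; k>n⇒nCk≡0; nC1≡n) renaming (_C_ to _choose_)
open import Data.Nat.Coprimality using (prime⇒coprime; coprime-Bézout)
open import Data.Nat.DivMod using (_%_; _mod_; %-distribˡ-+; %-distribˡ-*; m%n<n; n%n≡0; m*n%n≡0; m<n⇒m%n≡m)
open import Data.Nat.GCD using (module Bézout)
open import Data.Nat.Primality using (Prime; prime⇒nonTrivial)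
open import Data.Product using (∃; _×_; _,_; proj₁; proj₂)
open import Data.Sum using (_⊎_; inj₁; inj₂)
open import Data.Vec as Vec using ([]; _∷_)
open import Function.Bundles using (Equivalence)
open import Relation.Binary.Definitions using (DecidableEquality; tri<; tri≈; tri>)
open import Relation.Binary.PropositionalEquality as ≡ using (_≡_; _≢_; cong; cong₂; sym; subst; module ≡-Reasoning)
open import Relation.Nullary using (¬_; yes; no; contradiction)

-- Properness of `G` enters only through a coset disjoint from `G`, which gives 2|G| ≤ p. This bound
-- keeps the relevant integers nonzero in the field: the binomial coefficient C(d + m - 1, m) by
-- which the Taylor coefficient of order m of f is multiplied, and the factors k - 1, k + 3, m + n +
-- 2 and m - n. The two cases of the last equation are two signs. By minimality of k, the sum of (s
-- - e) ^ k over all pairs reduces to m σ ± n ε, where σ and ε are the k-th power sums of S and E.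
-- Its vanishing is a second linear relation between σ and ε besides the weighted equations. For k =
-- 1 the two relations coincide, which is why the sets are centred. If m ≠ n, the power sums of E
-- with exponents 1, ..., |E| all vanish, and a set with two elements or more does not allow that.
-- The equality mn = d is automatic: a sumset A + T covering G gives |A||T| ≥ |G|, the opposite of
-- Stepanov's bound. Each element of G is then a sum in one way only, so power sums of G are double
-- sums over A and T.

-- Counting with lists without repetition

module _ {A : Set} where

  Unique-resp-↭ : ∀ {xs ys : List A} → xs ↭ ys → Unique xs → Unique ys
  Unique-resp-↭ xs↭ys = Permutationₛ.Unique-resp-↭ (≡.setoid A) (↭⇒↭ₛ xs↭ys)

  ∈⇒↭∷ : ∀ {x} {xs : List A} → x ∈ xs → ∃ λ ys → xs ↭ x ∷ ys
  ∈⇒↭∷ x∈xs with ys , zs , ≡.refl ← ∈-∃++ x∈xs = ys ++ zs , shift _ ys zs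

  ∈∷∧≢⇒∈ : ∀ {y z} {zs : List A} → y ≢ z → z ∈ y ∷ zs → z ∈ zs
  ∈∷∧≢⇒∈ y≢z (here z≡y) = contradiction (sym z≡y) y≢z
  ∈∷∧≢⇒∈ y≢z (there z∈) = z∈

  Unique∧⊆⇒↭++ : ∀ {xs} ys → Unique ys → (∀ {y : A} → y ∈ ys → y ∈ xs) → ∃ λ zs → xs ↭ ys ++ zs
  Unique∧⊆⇒↭++ {xs} [] _ _ = xs , refl
  Unique∧⊆⇒↭++ (y ∷ ys) (y∉ys ∷ ys!) ys⊆xs
    with xs′ , xs↭ ← ∈⇒↭∷ (ys⊆xs (here ≡.refl))
    with zs , xs′↭ ← Unique∧⊆⇒↭++ {xs′} ys ys! (λ {z} z∈ys → ∈∷∧≢⇒∈ (All.lookup y∉ys z∈ys) (∈-resp-↭ xs↭ (ys⊆xs (there z∈ys))))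
    = zs , trans xs↭ (prep y xs′↭)

  Unique∧⊆⇒length≤ : ∀ {xs ys} → Unique ys → (∀ {y : A} → y ∈ ys → y ∈ xs) → length ys ≤ length xs
  Unique∧⊆⇒length≤ {xs} {ys} ys! ys⊆xs with zs , xs↭ ← Unique∧⊆⇒↭++ ys ys! ys⊆xs =
    ℕₚ.≤-trans (ℕₚ.m≤m+n _ (length zs)) (ℕₚ.≤-reflexive (sym (≡.trans (↭-length xs↭) (length-++ ys))))

  -- The bridge from counting to identities: once the lengths agree, sums and products over `xs` can
  -- be moved to `ys`.
  Unique∧⊆∧length≤⇒↭ : ∀ {xs ys} → Unique ys → (∀ {y : A} → y ∈ ys → y ∈ xs) → length xs ≤ length ys → xs ↭ ys
  Unique∧⊆∧length≤⇒↭ {xs} {ys} ys! ys⊆xs len with Unique∧⊆⇒↭++ ys ys! ys⊆xs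
  ... | [] , xs↭ = subst (xs ↭_) (++-identityʳ ys) xs↭
  ... | z ∷ zs , xs↭ = contradiction (ℕₚ.≤-trans (ℕₚ.≤-reflexive
          (≡.trans (sym (length-++ ys)) (sym (↭-length xs↭)))) len) (ℕₚ.m+1+n≰m (length ys))

length-cartesianProductWith : ∀ {A B C : Set} (f : A → B → C) xs ys →
  length (cartesianProductWith f xs ys) ≡ length xs ℕ.* length ys
length-cartesianProductWith f [] ys = ≡.refl
length-cartesianProductWith f (x ∷ xs) ys = ≡.trans (length-++ (map (f x) ys))
  (cong₂ ℕ._+_ (length-map (f x) ys) (length-cartesianProductWith f xs ys))

-- Commutative rings: integer multiples, the ring solver, finite sums

module Ring {F : Set} {add mul : Op₂ F} {neg : Op₁ F} {𝟘 𝟙 : F}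
  (isCommutativeRing : IsCommutativeRing _≡_ add mul neg 𝟘 𝟙) where

  commutativeRing : CommutativeRing 0ℓ 0ℓ
  commutativeRing = record { isCommutativeRing = isCommutativeRing }

  open CommutativeRing commutativeRing public
    using (_+_; _*_; -_; _-_; 0#; 1#; +-assoc; +-comm; +-identityˡ; +-identityʳ; -‿inverseˡ; -‿inverseʳ;
           *-assoc; *-comm; *-identityˡ; *-identityʳ; distribˡ; distribʳ; zeroˡ; zeroʳ)
  open RingProperties (CommutativeRing.ring commutativeRing) public
    using (-‿distribˡ-*; -‿distribʳ-*; -0#≈0#; -‿involutive)
  open AbelianGroupProperties (CommutativeRing.+-abelianGroup commutativeRing)
    using () renaming (⁻¹-∙-comm to -‿+-comm)
  open Multiples (CommutativeRing.semiring commutativeRing)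
    using (1+×; ×-homo-+; ×1-homo-*) renaming (_×_ to _·_)

  ι : ℕ → F
  ι n = n · 1#

  ι-suc : ∀ n → ι (suc n) ≡ 1# + ι n
  ι-suc n = 1+× n 1#

  ι-+ : ∀ m n → ι (m ℕ.+ n) ≡ ι m + ι n
  ι-+ = ×-homo-+ 1#

  ι-* : ∀ m n → ι (m ℕ.* n) ≡ ι m * ι n
  ι-* = ×1-homo-*

  -- The ring solver needs coefficients with decidable equality in normal form, hence ℤ.
  private
    ⟦_⟧ : ℤ → F
    ⟦ pos n ⟧ = ι n
    ⟦ -[1+ n ] ⟧ = - ι (suc n)

    ⟦⊖⟧ : ∀ m n → ⟦ m ℤ.⊖ n ⟧ ≡ ι m - ι n
    ⟦⊖⟧ m zero = sym (≡.trans (cong (ι m +_) -0#≈0#) (+-identityʳ _))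
    ⟦⊖⟧ zero (suc n) = sym (+-identityˡ _)
    ⟦⊖⟧ (suc m) (suc n) = begin
      ⟦ suc m ℤ.⊖ suc n ⟧           ≡⟨ cong ⟦_⟧ (ℤₚ.[1+m]⊖[1+n]≡m⊖n m n) ⟩
      ⟦ m ℤ.⊖ n ⟧                   ≡⟨ ⟦⊖⟧ m n ⟩
      ι m - ι n                     ≡⟨ +-identityˡ _ ⟨
      0# + (ι m - ι n)              ≡⟨ cong (_+ (ι m - ι n)) (-‿inverseʳ 1#) ⟨
      (1# - 1#) + (ι m - ι n)       ≡⟨ +-assoc _ _ _ ⟩
      1# + (- 1# + (ι m - ι n))     ≡⟨ cong (1# +_) (+-assoc _ _ _) ⟨
      1# + ((- 1# + ι m) - ι n)     ≡⟨ cong (λ t → 1# + (t - ι n)) (+-comm _ _) ⟩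
      1# + ((ι m - 1#) - ι n)       ≡⟨ cong (1# +_) (+-assoc _ _ _) ⟩
      1# + (ι m + (- 1# - ι n))     ≡⟨ +-assoc _ _ _ ⟨
      (1# + ι m) + (- 1# - ι n)     ≡⟨ cong₂ _+_ (sym (ι-suc m)) (-‿+-comm _ _) ⟩
      ι (suc m) - (1# + ι n)        ≡⟨ cong (λ t → ι (suc m) - t) (ι-suc n) ⟨
      ι (suc m) - ι (suc n)         ∎
      where open ≡-Reasoning

    ⟦⟧-+ : ∀ i j → ⟦ i ℤ.+ j ⟧ ≡ ⟦ i ⟧ + ⟦ j ⟧
    ⟦⟧-+ (pos m) (pos n) = ι-+ m n
    ⟦⟧-+ (pos m) -[1+ n ] = ⟦⊖⟧ m (suc n)
    ⟦⟧-+ -[1+ m ] (pos n) = ≡.trans (⟦⊖⟧ n (suc m)) (+-comm _ _)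
    ⟦⟧-+ -[1+ m ] -[1+ n ] = begin
      - ι (suc (suc (m ℕ.+ n)))        ≡⟨ cong (λ k → - ι k) (cong suc (ℕₚ.+-suc m n)) ⟨
      - ι (suc m ℕ.+ suc n)            ≡⟨ cong -_ (ι-+ (suc m) (suc n)) ⟩
      - (ι (suc m) + ι (suc n))        ≡⟨ -‿+-comm _ _ ⟨
      - ι (suc m) - ι (suc n)          ∎
      where open ≡-Reasoning

    ⟦⟧-neg : ∀ i → ⟦ ℤ.- i ⟧ ≡ - ⟦ i ⟧
    ⟦⟧-neg (pos zero) = sym -0#≈0#
    ⟦⟧-neg (pos (suc n)) = ≡.refl
    ⟦⟧-neg -[1+ n ] = sym (-‿involutive _)

    ⟦⟧-+* : ∀ m j → ⟦ pos m ℤ.* j ⟧ ≡ ι m * ⟦ j ⟧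
    ⟦⟧-+* m (pos n) = ≡.trans (cong ⟦_⟧ (sym (ℤₚ.pos-* m n))) (ι-* m n)
    ⟦⟧-+* m -[1+ n ] = begin
      ⟦ pos m ℤ.* -[1+ n ] ⟧             ≡⟨ cong ⟦_⟧ (ℤₚ.neg-distribʳ-* (pos m) (pos (suc n))) ⟨
      ⟦ ℤ.- (pos m ℤ.* pos (suc n)) ⟧        ≡⟨ ⟦⟧-neg (pos m ℤ.* pos (suc n)) ⟩
      - ⟦ pos m ℤ.* pos (suc n) ⟧            ≡⟨ cong -_ (⟦⟧-+* m (pos (suc n))) ⟩
      - (ι m * ι (suc n))              ≡⟨ -‿distribʳ-* _ _ ⟩
      ι m * - ι (suc n)                ∎
      where open ≡-Reasoning

    ⟦⟧-* : ∀ i j → ⟦ i ℤ.* j ⟧ ≡ ⟦ i ⟧ * ⟦ j ⟧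
    ⟦⟧-* (pos m) j = ⟦⟧-+* m j
    ⟦⟧-* -[1+ m ] j = begin
      ⟦ -[1+ m ] ℤ.* j ⟧               ≡⟨ cong ⟦_⟧ (ℤₚ.neg-distribˡ-* (pos (suc m)) j) ⟨
      ⟦ ℤ.- (pos (suc m) ℤ.* j) ⟧          ≡⟨ ⟦⟧-neg (pos (suc m) ℤ.* j) ⟩
      - ⟦ pos (suc m) ℤ.* j ⟧              ≡⟨ cong -_ (⟦⟧-+* (suc m) j) ⟩
      - (ι (suc m) * ⟦ j ⟧)            ≡⟨ -‿distribˡ-* _ _ ⟩
      - ι (suc m) * ⟦ j ⟧              ∎
      where open ≡-Reasoning

    almostCommutativeRing : AlmostCommutativeRing 0ℓ 0ℓ
    almostCommutativeRing = fromCommutativeRing commutativeRing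

    ℤ⟶F : CommutativeRing.rawRing ℤₚ.+-*-commutativeRing -Raw-AlmostCommutative⟶ almostCommutativeRing
    ℤ⟶F = record { ⟦_⟧ = ⟦_⟧ ; +-homo = ⟦⟧-+ ; *-homo = ⟦⟧-* ; -‿homo = ⟦⟧-neg ; 0-homo = ≡.refl ; 1-homo = ≡.refl }

    _≟ℤ_ : ∀ i j → Maybe (⟦ i ⟧ ≡ ⟦ j ⟧)
    i ≟ℤ j with i ℤₚ.≟ j
    ... | yes i≡j = just (cong ⟦_⟧ i≡j)
    ... | no  _   = nothing

  open RingSolver (CommutativeRing.rawRing ℤₚ.+-*-commutativeRing) almostCommutativeRing ℤ⟶F _≟ℤ_ public
    using (solve; _:=_; _:+_; _:*_; _:-_; :-_; con)

  x-y≡0⇒x≡y : ∀ {x y} → x - y ≡ 0# → x ≡ y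
  x-y≡0⇒x≡y {x} {y} eq = begin
    x              ≡⟨ solve 2 (λ x y → x := (x :- y) :+ y) ≡.refl x y ⟩
    (x - y) + y    ≡⟨ cong (_+ y) eq ⟩
    0# + y         ≡⟨ +-identityˡ y ⟩
    y              ∎
    where open ≡-Reasoning

  x≡y⇒x-y≡0 : ∀ {x y} → x ≡ y → x - y ≡ 0#
  x≡y⇒x-y≡0 {x} ≡.refl = -‿inverseʳ x

  private variable A B : Set

  ∑ : List A → (A → F) → F
  ∑ [] f = 0#
  ∑ (x ∷ xs) f = f x + ∑ xs f

  ∑-cong : ∀ (xs : List A) {f g : A → F} → (∀ {x} → x ∈ xs → f x ≡ g x) → ∑ xs f ≡ ∑ xs g
  ∑-cong [] eq = ≡.refl
  ∑-cong (x ∷ xs) eq = cong₂ _+_ (eq (here ≡.refl)) (∑-cong xs λ x∈ → eq (there x∈))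

  ∑-0 : ∀ (xs : List A) → ∑ xs (λ _ → 0#) ≡ 0#
  ∑-0 [] = ≡.refl
  ∑-0 (x ∷ xs) = ≡.trans (+-identityˡ _) (∑-0 xs)

  ∑-zero : ∀ (xs : List A) {f : A → F} → (∀ {x} → x ∈ xs → f x ≡ 0#) → ∑ xs f ≡ 0#
  ∑-zero xs eq = ≡.trans (∑-cong xs eq) (∑-0 xs)

  ∑-+ : ∀ (xs : List A) (f g : A → F) → ∑ xs (λ x → f x + g x) ≡ ∑ xs f + ∑ xs g
  ∑-+ [] f g = sym (+-identityˡ _)
  ∑-+ (x ∷ xs) f g = ≡.trans (cong (f x + g x +_) (∑-+ xs f g))
    (solve 4 (λ a b c d → (a :+ b) :+ (c :+ d) := (a :+ c) :+ (b :+ d)) ≡.refl (f x) (g x) (∑ xs f) (∑ xs g))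

  ∑-*ˡ : ∀ (xs : List A) c (f : A → F) → ∑ xs (λ x → c * f x) ≡ c * ∑ xs f
  ∑-*ˡ [] c f = sym (zeroʳ c)
  ∑-*ˡ (x ∷ xs) c f = ≡.trans (cong (c * f x +_) (∑-*ˡ xs c f)) (sym (distribˡ c _ _))

  ∑-neg : ∀ (xs : List A) (f : A → F) → ∑ xs (λ x → - f x) ≡ - ∑ xs f
  ∑-neg [] f = sym -0#≈0#
  ∑-neg (x ∷ xs) f = ≡.trans (cong (- f x +_) (∑-neg xs f)) (-‿+-comm _ _)

  ∑-- : ∀ (xs : List A) (f g : A → F) → ∑ xs (λ x → f x - g x) ≡ ∑ xs f - ∑ xs g
  ∑-- xs f g = ≡.trans (∑-+ xs f (λ x → - g x)) (cong (∑ xs f +_) (∑-neg xs g))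

  ∑-const : ∀ (xs : List A) c → ∑ xs (λ _ → c) ≡ ι (length xs) * c
  ∑-const [] c = sym (zeroˡ c)
  ∑-const (x ∷ xs) c = begin
    c + ∑ xs (λ _ → c)           ≡⟨ cong (c +_) (∑-const xs c) ⟩
    c + ι (length xs) * c        ≡⟨ solve 2 (λ c l → c :+ l :* c := (con (pos 1) :+ l) :* c) ≡.refl c _ ⟩
    (1# + ι (length xs)) * c     ≡⟨ cong (_* c) (ι-suc (length xs)) ⟨
    ι (suc (length xs)) * c      ∎
    where open ≡-Reasoning

  ∑-swap : ∀ (xs : List A) (ys : List B) (f : A → B → F) →
    ∑ xs (λ x → ∑ ys (f x)) ≡ ∑ ys (λ y → ∑ xs (λ x → f x y))
  ∑-swap [] ys f = sym (∑-0 ys)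
  ∑-swap (x ∷ xs) ys f = ≡.trans (cong (∑ ys (f x) +_) (∑-swap xs ys f)) (sym (∑-+ ys (f x) _))

  ∑-map : ∀ (xs : List A) (g : A → B) (f : B → F) → ∑ (map g xs) f ≡ ∑ xs (λ x → f (g x))
  ∑-map [] g f = ≡.refl
  ∑-map (x ∷ xs) g f = cong (f (g x) +_) (∑-map xs g f)

  ∑-++ : ∀ (xs ys : List A) (f : A → F) → ∑ (xs ++ ys) f ≡ ∑ xs f + ∑ ys f
  ∑-++ [] ys f = sym (+-identityˡ _)
  ∑-++ (x ∷ xs) ys f = ≡.trans (cong (f x +_) (∑-++ xs ys f)) (sym (+-assoc _ _ _))

  ∑-cartesian : ∀ {C : Set} (g : A → B → C) (xs : List A) (ys : List B) (f : C → F) →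
    ∑ (cartesianProductWith g xs ys) f ≡ ∑ xs (λ x → ∑ ys (λ y → f (g x y)))
  ∑-cartesian g [] ys f = ≡.refl
  ∑-cartesian g (x ∷ xs) ys f = ≡.trans (∑-++ (map (g x) ys) _ f)
    (cong₂ _+_ (∑-map ys (g x) f) (∑-cartesian g xs ys f))

  ∑-↭ : ∀ {xs ys : List A} → xs ↭ ys → (f : A → F) → ∑ xs f ≡ ∑ ys f
  ∑-↭ refl f = ≡.refl
  ∑-↭ (prep x xs↭ys) f = cong (f x +_) (∑-↭ xs↭ys f)
  ∑-↭ (swap {xs} {ys} x y xs↭ys) f = ≡.trans (cong (λ t → f x + (f y + t)) (∑-↭ xs↭ys f))
    (solve 3 (λ a b c → a :+ (b :+ c) := b :+ (a :+ c)) ≡.refl (f x) (f y) (∑ ys f))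
  ∑-↭ (trans xs↭ys ys↭zs) f = ≡.trans (∑-↭ xs↭ys f) (∑-↭ ys↭zs f)

-- Fields in which the positive integers below `p` are nonzero

record IsFieldOfCharacteristic≥ (p : ℕ) {F : Set} (add mul : Op₂ F) (neg : Op₁ F) (𝟘 𝟙 : F) : Set where
  field
    isCommutativeRing : IsCommutativeRing _≡_ add mul neg 𝟘 𝟙
  open Ring isCommutativeRing using (ι)
  field
    _≟_     : DecidableEquality F
    inverse : ∀ x → x ≢ 𝟘 → ∃ λ y → mul x y ≡ 𝟙
    ι≢0     : ∀ k → 0 < k → k < p → ι k ≢ 𝟘

module Field {p : ℕ} {F : Set} {add mul : Op₂ F} {neg : Op₁ F} {𝟘 𝟙 : F}
  (isField : IsFieldOfCharacteristic≥ p add mul neg 𝟘 𝟙) (1<p : 1 < p) where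

  open IsFieldOfCharacteristic≥ isField public
  open Ring isCommutativeRing public
  open Exponentiation (CommutativeRing.commutativeSemiring commutativeRing) public using (_^_; ^-distrib-*)

  1≢0 : 1# ≢ 0#
  1≢0 = ι≢0 1 (s≤s z≤n) 1<p

  -- Total, with value `0#` at `0#`, so that a sum of `inv (y - x)` over a whole set may include
  -- `x = y` at no cost.
  inv : F → F
  inv x with x ≟ 0#
  ... | yes _   = 0#
  ... | no  x≢0 = proj₁ (inverse x x≢0)

  *-inv : ∀ {x} → x ≢ 0# → x * inv x ≡ 1#
  *-inv {x} x≢0 with x ≟ 0#
  ... | yes x≡0 = contradiction x≡0 x≢0
  ... | no  x≢0′ = proj₂ (inverse x x≢0′)

  inv-0 : ∀ {x} → x ≡ 0# → inv x ≡ 0#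
  inv-0 {x} x≡0 with x ≟ 0#
  ... | yes _   = ≡.refl
  ... | no  x≢0 = contradiction x≡0 x≢0

  xy≡0⇒y≡0 : ∀ {x y} → x ≢ 0# → x * y ≡ 0# → y ≡ 0#
  xy≡0⇒y≡0 {x} {y} x≢0 xy≡0 = begin
    y                  ≡⟨ *-identityˡ y ⟨
    1# * y             ≡⟨ cong (_* y) (*-inv x≢0) ⟨
    (x * inv x) * y    ≡⟨ solve 3 (λ x i y → (x :* i) :* y := i :* (x :* y)) ≡.refl x (inv x) y ⟩
    inv x * (x * y)    ≡⟨ cong (inv x *_) xy≡0 ⟩
    inv x * 0#         ≡⟨ zeroʳ _ ⟩
    0#                 ∎
    where open ≡-Reasoning

  xy≢0 : ∀ {x y} → x ≢ 0# → y ≢ 0# → x * y ≢ 0#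
  xy≢0 x≢0 y≢0 xy≡0 = y≢0 (xy≡0⇒y≡0 x≢0 xy≡0)

  *-cancelˡ : ∀ {x y z} → x ≢ 0# → x * y ≡ x * z → y ≡ z
  *-cancelˡ {x} {y} {z} x≢0 eq = x-y≡0⇒x≡y (xy≡0⇒y≡0 x≢0 (≡.trans
    (solve 3 (λ x y z → x :* (y :- z) := x :* y :- x :* z) ≡.refl x y z) (x≡y⇒x-y≡0 eq)))

  x≢y⇒x-y≢0 : ∀ {x y} → x ≢ y → x - y ≢ 0#
  x≢y⇒x-y≢0 x≢y eq = x≢y (x-y≡0⇒x≡y eq)

  0^suc : ∀ n → 0# ^ suc n ≡ 0#
  0^suc n = zeroˡ _

  ^≢0 : ∀ {x d η} → 0 < d → η ≢ 0# → x ^ d ≡ η → x ≢ 0#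
  ^≢0 {d = suc d} _ η≢0 x^d≡η ≡.refl = η≢0 (≡.trans (sym x^d≡η) (0^suc d))

  ι-∸ : ∀ {m n} → m ≤ n → ι (n ∸ m) ≡ ι n - ι m
  ι-∸ {m} {n} m≤n = begin
    ι (n ∸ m)                    ≡⟨ solve 2 (λ a b → a := (a :+ b) :- b) ≡.refl (ι (n ∸ m)) (ι m) ⟩
    (ι (n ∸ m) + ι m) - ι m      ≡⟨ cong (_- ι m) (ι-+ (n ∸ m) m) ⟨
    ι (n ∸ m ℕ.+ m) - ι m        ≡⟨ cong (λ k → ι k - ι m) (ℕₚ.m∸n+n≡m m≤n) ⟩
    ι n - ι m                    ∎
    where open ≡-Reasoning

  -- Binomial coefficients

  binom : ℕ → ℕ → F
  binom n k = ι (n choose k)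

  binom-> : ∀ {n k} → n < k → binom n k ≡ 0#
  binom-> n<k = cong ι (k>n⇒nCk≡0 n<k)

  pascal : ∀ n k → binom (suc n) (suc k) ≡ binom n k + binom n (suc k)
  pascal n k = ≡.trans (cong ι (sym (nCk+nC[k+1]≡[n+1]C[k+1] n k))) (ι-+ (n choose k) _)

  -- The ratio of consecutive binomial coefficients, free of division. It yields both their
  -- nonvanishing below `p` and, later, the factor `d - 1` of the electrostatic equations.
  binom-step : ∀ n k → ι (suc k) * binom n (suc k) ≡ (ι n - ι k) * binom n k
  binom-step zero zero = ≡.trans (cong (1# *_) (binom-> {0} {1} (s≤s z≤n)))
    (solve 0 (con (pos 1) :* con (pos 0) := (con (pos 0) :- con (pos 0)) :* con (pos 1)) ≡.refl)
  binom-step zero (suc k) = ≡.trans (cong (ι (suc (suc k)) *_) (binom-> {0} {suc (suc k)} (s≤s z≤n)))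
    (≡.trans (zeroʳ _) (sym (≡.trans (cong ((ι 0 - ι (suc k)) *_) (binom-> {0} {suc k} (s≤s z≤n))) (zeroʳ _))))
  binom-step (suc n) zero = begin
    1# * binom (suc n) 1                     ≡⟨ cong (λ k → 1# * ι k) (nC1≡n (suc n)) ⟩
    1# * ι (suc n)                           ≡⟨ solve 1 (λ n → con (pos 1) :* n := (n :- con (pos 0)) :* con (pos 1)) ≡.refl (ι (suc n)) ⟩
    (ι (suc n) - 0#) * 1#                    ∎
    where open ≡-Reasoning
  binom-step (suc n) (suc k) = begin
    ι (2 ℕ.+ k) * binom (suc n) (2 ℕ.+ k)
      ≡⟨ cong₂ _*_ (ι-suc (suc k)) (pascal n (suc k)) ⟩
    (1# + ι (suc k)) * (b + c)
      ≡⟨ solve 3 (λ i b c → (con (pos 1) :+ i) :* (b :+ c) := i :* b :+ b :+ (con (pos 1) :+ i) :* c) ≡.refl (ι (suc k)) b c ⟩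
    ι (suc k) * b + b + (1# + ι (suc k)) * c
      ≡⟨ cong₂ (λ x y → x + b + y) (binom-step n k) (≡.trans (cong (_* c) (sym (ι-suc (suc k)))) (binom-step n (suc k))) ⟩
    (ι n - ι k) * a + b + (ι n - ι (suc k)) * b
      ≡⟨ cong (λ i → (ι n - ι k) * a + b + (ι n - i) * b) (ι-suc k) ⟩
    (ι n - ι k) * a + b + (ι n - (1# + ι k)) * b
      ≡⟨ solve 4 (λ n k a b → (n :- k) :* a :+ b :+ (n :- (con (pos 1) :+ k)) :* b
           := ((con (pos 1) :+ n) :- (con (pos 1) :+ k)) :* (a :+ b)) ≡.refl (ι n) (ι k) a b ⟩
    ((1# + ι n) - (1# + ι k)) * (a + b)
      ≡⟨ cong₂ _*_ (cong₂ _-_ (ι-suc n) (ι-suc k)) (pascal n k) ⟨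
    (ι (suc n) - ι (suc k)) * binom (suc n) (suc k) ∎
    where
    open ≡-Reasoning
    a = binom n k
    b = binom n (suc k)
    c = binom n (suc (suc k))

  -- Induction on `k` by `binom-step`: the factor `n - k` is an integer strictly between `0` and
  -- `p`.
  binom≢0 : ∀ {n} → n < p → ∀ k → k ≤ n → binom n k ≢ 0#
  binom≢0 n<p zero _ = 1≢0
  binom≢0 {n} n<p (suc k) k<n eq = xy≢0 n-k≢0 (binom≢0 n<p k (ℕₚ.<⇒≤ k<n)) (begin
    (ι n - ι k) * binom n k          ≡⟨ binom-step n k ⟨
    ι (suc k) * binom n (suc k)      ≡⟨ cong (ι (suc k) *_) eq ⟩
    ι (suc k) * 0#                   ≡⟨ zeroʳ _ ⟩
    0#                               ∎)
    where
    open ≡-Reasoning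
    n-k≢0 : ι n - ι k ≢ 0#
    n-k≢0 eq′ = ι≢0 (n ∸ k) (ℕₚ.m<n⇒0<n∸m k<n) (ℕₚ.≤-<-trans (ℕₚ.m∸n≤m n k) n<p)
      (≡.trans (ι-∸ (ℕₚ.<⇒≤ k<n)) eq′)

  -- Complete homogeneous symmetric polynomials

  h : List F → ℕ → F
  h []       zero    = 1#
  h []       (suc j) = 0#
  h (y ∷ ys) zero    = 1#
  h (y ∷ ys) (suc j) = h ys (suc j) + y * h (y ∷ ys) j

  h-zero : ∀ ys → h ys 0 ≡ 1#
  h-zero [] = ≡.refl
  h-zero (_ ∷ _) = ≡.refl

  -- In generating functions: 1 / (1 - y t) - 1 / (1 - z t) = (y - z) t / ((1 - y t) (1 - z t)).
  h-divided-difference : ∀ y z ys j → (y - z) * h (y ∷ z ∷ ys) j ≡ h (y ∷ ys) (suc j) - h (z ∷ ys) (suc j)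
  h-divided-difference y z ys zero =
    solve 3 (λ y z t → (y :- z) :* con (pos 1) := (t :+ y :* con (pos 1)) :- (t :+ z :* con (pos 1))) ≡.refl y z (h ys 1)
  h-divided-difference y z ys (suc j) = begin
    (y - z) * (Z + y * H)                    ≡⟨ solve 4 (λ y z Z H → (y :- z) :* (Z :+ y :* H) := (y :- z) :* Z :+ y :* ((y :- z) :* H)) ≡.refl y z Z H ⟩
    (y - z) * Z + y * ((y - z) * H)          ≡⟨ cong (λ t → (y - z) * Z + y * t) (h-divided-difference y z ys j) ⟩
    (y - z) * Z + y * (Y - Z)                ≡⟨ solve 5 (λ y z Y Z t → (y :- z) :* Z :+ y :* (Y :- Z) := (t :+ y :* Y) :- (t :+ z :* Z)) ≡.refl y z Y Z (h ys (2 ℕ.+ j)) ⟩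
    h (y ∷ ys) (2 ℕ.+ j) - h (z ∷ ys) (2 ℕ.+ j) ∎
    where
    open ≡-Reasoning
    H = h (y ∷ z ∷ ys) j
    Y = h (y ∷ ys) (suc j)
    Z = h (z ∷ ys) (suc j)

  h-singleton : ∀ y j → h (y ∷ []) j ≡ y ^ j
  h-singleton y zero = ≡.refl
  h-singleton y (suc j) = ≡.trans (+-identityˡ _) (cong (y *_) (h-singleton y j))

  ∑inv : List F → F
  ∑inv ys = ∑ ys inv

  -- If the y in ys are distinct and satisfy y ^ d = η, then ∏ (1 - y t) divides 1 - η t ^ d. Hence
  -- ∑ⱼ hⱼ tʲ = 1 / ∏ (1 - y t) is a polynomial of degree d - |ys| divided by 1 - η t ^ d: the
  -- coefficients vanish strictly between d - |ys| and d, and h_d = η.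
  module _ {d : ℕ} {η : F} (0<d : 0 < d) (η≢0 : η ≢ 0#) where

    IsRoot : F → Set
    IsRoot y = y ^ d ≡ η

    private
      extend-degree : ∀ y ys → h ys d ≡ η → (∀ j → j ℕ.+ 1 ≡ d → h (y ∷ ys) j ≡ 0#) → h (y ∷ ys) d ≡ η
      extend-degree y ys hd≡η h≡0 = go d 0<d ≡.refl
        where
        go : ∀ k → 0 < k → k ≡ d → h (y ∷ ys) k ≡ η
        go (suc k) _ eq = begin
          h ys (suc k) + y * h (y ∷ ys) k
            ≡⟨ cong₂ (λ a b → a + y * b) (≡.trans (cong (h ys) eq) hd≡η) (h≡0 k (≡.trans (ℕₚ.+-comm k 1) eq)) ⟩
          η + y * 0#      ≡⟨ solve 2 (λ e y → e :+ y :* con (pos 0) := e) ≡.refl η y ⟩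
          η               ∎
          where open ≡-Reasoning

    -- Here `j = d - 1 - l`. The divided difference expresses the coefficient through two lists
    -- shorter by one entry, at degree `j + 1`. For `l = 0` both values are `η` by `h-degree`, for
    -- larger `l` both lie in the shorter gaps; either way they cancel.
    h-gap : ∀ y ys → Unique (y ∷ ys) → All IsRoot (y ∷ ys) →
      ∀ l j → l < length ys → j ℕ.+ suc l ≡ d → h (y ∷ ys) j ≡ 0#
    h-degree : ∀ y ys → Unique (y ∷ ys) → All IsRoot (y ∷ ys) → h (y ∷ ys) d ≡ η

    h-gap y (z ∷ zs) ((y≢z ∷ y∉) ∷ (z∉ ∷ zs!)) (ry ∷ rz ∷ rs) l j l< eq =
      xy≡0⇒y≡0 (x≢y⇒x-y≢0 y≢z) (≡.trans (h-divided-difference y z zs j) (x≡y⇒x-y≡0 (equal l l< eq)))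
      where
      equal : ∀ l → l < suc (length zs) → j ℕ.+ suc l ≡ d → h (y ∷ zs) (suc j) ≡ h (z ∷ zs) (suc j)
      equal zero _ eq = subst (λ k → h (y ∷ zs) k ≡ h (z ∷ zs) k) (≡.trans (sym eq) (ℕₚ.+-comm j 1))
        (≡.trans (h-degree y zs (y∉ ∷ zs!) (ry ∷ rs)) (sym (h-degree z zs (z∉ ∷ zs!) (rz ∷ rs))))
      equal (suc l) (s≤s l<) eq = ≡.trans (h-gap y zs (y∉ ∷ zs!) (ry ∷ rs) l (suc j) l< eq′)
        (sym (h-gap z zs (z∉ ∷ zs!) (rz ∷ rs) l (suc j) l< eq′))
        where
        eq′ : suc j ℕ.+ suc l ≡ d
        eq′ = ≡.trans (sym (ℕₚ.+-suc j (suc l))) eq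

    h-degree y [] _ (ry ∷ []) = ≡.trans (h-singleton y d) ry
    h-degree y (z ∷ zs) ys!@(_ ∷ zs!) rs@(_ ∷ rs′) =
      extend-degree y (z ∷ zs) (h-degree z zs zs! rs′) (λ j eq → h-gap y (z ∷ zs) ys! rs 0 j (s≤s z≤n) eq)

    private
      -- The left side of the defining recursion, `h (y ∷ z ∷ zs) (suc j)`, is the lowest
      -- coefficient in the gap and vanishes.
      h-recursion : ∀ y z zs → Unique (y ∷ z ∷ zs) → All IsRoot (y ∷ z ∷ zs) →
        ∀ j → j ℕ.+ suc (length (z ∷ zs)) ≡ d → h (z ∷ zs) (suc j) ≡ - (y * h (y ∷ z ∷ zs) j)
      h-recursion y z zs ys! rs j eq = begin
        h (z ∷ zs) (suc j)                               ≡⟨ solve 2 (λ a b → a := (a :+ b) :- b) ≡.refl (h (z ∷ zs) (suc j)) (y * h (y ∷ z ∷ zs) j) ⟩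
        h (y ∷ z ∷ zs) (suc j) - y * h (y ∷ z ∷ zs) j    ≡⟨ cong (_- (y * h (y ∷ z ∷ zs) j)) (h-gap y (z ∷ zs) ys! rs (length zs) (suc j) ℕₚ.≤-refl (≡.trans (sym (ℕₚ.+-suc j _)) eq)) ⟩
        0# - y * h (y ∷ z ∷ zs) j                        ≡⟨ +-identityˡ _ ⟩
        - (y * h (y ∷ z ∷ zs) j)                         ∎
        where open ≡-Reasoning

    -- This is the leading coefficient of the polynomial (1 - η t ^ d) / ∏ (1 - y t). By
    -- `h-recursion` its vanishing would pass to the list without `y`, and finally to y ^ (d - 1)
    -- for a single `y`, although y times that power is `η`.
    h-top≢0 : ∀ y ys → Unique (y ∷ ys) → All IsRoot (y ∷ ys) →
      ∀ j → j ℕ.+ suc (length ys) ≡ d → h (y ∷ ys) j ≢ 0#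
    h-top≢0 y [] ys! (ry ∷ []) j eq hj≡0 = η≢0 (begin
      η                       ≡⟨ ry ⟨
      y ^ d                   ≡⟨ cong (y ^_) (≡.trans (sym eq) (ℕₚ.+-comm j 1)) ⟩
      y * y ^ j               ≡⟨ cong (y *_) (≡.trans (sym (h-singleton y j)) hj≡0) ⟩
      y * 0#                  ≡⟨ zeroʳ y ⟩
      0#                      ∎)
      where open ≡-Reasoning
    h-top≢0 y (z ∷ zs) ys!@(_ ∷ zs!) r@(_ ∷ rs) j eq hj≡0 =
      h-top≢0 z zs zs! rs (suc j) (≡.trans (sym (ℕₚ.+-suc j _)) eq) (begin
        h (z ∷ zs) (suc j)             ≡⟨ h-recursion y z zs ys! r j eq ⟩
        - (y * h (y ∷ z ∷ zs) j)       ≡⟨ cong (λ t → - (y * t)) hj≡0 ⟩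
        - (y * 0#)                     ≡⟨ solve 1 (λ y → :- (y :* con (pos 0)) := con (pos 0)) ≡.refl y ⟩
        0#                             ∎)
      where open ≡-Reasoning

    -- Expand (1 - η t ^ d) / ∏ (1 - y t) in powers of 1 / t: each factor 1 / (1 - 1 / (y t))
    -- contributes 1 / y to the ratio of the two highest coefficients. The reciprocals 1 / (s - e)
    -- of the electrostatic equations originate here.
    h-subtop : ∀ y ys → Unique (y ∷ ys) → All IsRoot (y ∷ ys) →
      ∀ i → suc i ℕ.+ suc (length ys) ≡ d → h (y ∷ ys) i ≡ ∑inv (y ∷ ys) * h (y ∷ ys) (suc i)
    h-subtop y ys ys! r@(ry ∷ _) i eq = begin
      hᵢ                                ≡⟨ *-identityˡ hᵢ ⟨
      1# * hᵢ                           ≡⟨ cong (_* hᵢ) (*-inv y≢0) ⟨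
      (y * inv y) * hᵢ                  ≡⟨ solve 4 (λ y i a x → (y :* i) :* x := i :* ((a :+ y :* x) :- a)) ≡.refl y (inv y) (h ys (suc i)) hᵢ ⟩
      inv y * (hₛ - h ys (suc i))       ≡⟨ cong (λ t → inv y * (hₛ - t)) (rest ys ys! r eq) ⟩
      inv y * (hₛ - - (y * σ * hₛ))     ≡⟨ solve 4 (λ i x y s → i :* (x :- :- (y :* s :* x)) := i :* x :+ (y :* i) :* (s :* x)) ≡.refl (inv y) hₛ y σ ⟩
      inv y * hₛ + (y * inv y) * (σ * hₛ)   ≡⟨ cong (λ t → inv y * hₛ + t * (σ * hₛ)) (*-inv y≢0) ⟩
      inv y * hₛ + 1# * (σ * hₛ)        ≡⟨ solve 3 (λ i x s → i :* x :+ con (pos 1) :* (s :* x) := (i :+ s) :* x) ≡.refl (inv y) hₛ σ ⟩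
      (inv y + σ) * hₛ                  ∎
      where
      open ≡-Reasoning
      y≢0 = ^≢0 0<d η≢0 ry
      σ = ∑inv ys
      hᵢ = h (y ∷ ys) i
      hₛ = h (y ∷ ys) (suc i)
      rest : ∀ ys → Unique (y ∷ ys) → All IsRoot (y ∷ ys) → suc i ℕ.+ suc (length ys) ≡ d →
        h ys (suc i) ≡ - (y * ∑inv ys * h (y ∷ ys) (suc i))
      rest [] _ _ _ = solve 2 (λ y x → con (pos 0) := :- (y :* con (pos 0) :* x)) ≡.refl y (h (y ∷ []) (suc i))
      rest (z ∷ zs) ys!@(_ ∷ zs!) r@(_ ∷ rs) eq = begin
        h (z ∷ zs) (suc i)
          ≡⟨ h-subtop z zs zs! rs (suc i) (≡.trans (sym (ℕₚ.+-suc (suc i) _)) eq) ⟩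
        ∑inv (z ∷ zs) * h (z ∷ zs) (2 ℕ.+ i)
          ≡⟨ cong (∑inv (z ∷ zs) *_) (h-recursion y z zs ys! r (suc i) eq) ⟩
        ∑inv (z ∷ zs) * - (y * h (y ∷ z ∷ zs) (suc i))
          ≡⟨ solve 3 (λ s y x → s :* :- (y :* x) := :- (y :* s :* x)) ≡.refl (∑inv (z ∷ zs)) y (h (y ∷ z ∷ zs) (suc i)) ⟩
        - (y * ∑inv (z ∷ zs) * h (y ∷ z ∷ zs) (suc i)) ∎

  -- Polynomials as coefficient lists, constant term first

  Poly : Set
  Poly = List F

  -- taylor f s l is the coefficient of (x - s) ^ l in f.
  taylor : Poly → F → ℕ → F
  taylor []      s l       = 0#
  taylor (c ∷ f) s zero    = c + s * taylor f s zero
  taylor (c ∷ f) s (suc l) = s * taylor f s (suc l) + taylor f s l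

  taylor-length≤ : ∀ f s l → length f ≤ l → taylor f s l ≡ 0#
  taylor-length≤ [] s l _ = ≡.refl
  taylor-length≤ (c ∷ f) s (suc l) (s≤s len) = begin
    s * taylor f s (suc l) + taylor f s l      ≡⟨ cong₂ (λ a b → s * a + b) (taylor-length≤ f s (suc l) (ℕₚ.m≤n⇒m≤1+n len)) (taylor-length≤ f s l len) ⟩
    s * 0# + 0#                                ≡⟨ solve 1 (λ s → s :* con (pos 0) :+ con (pos 0) := con (pos 0)) ≡.refl s ⟩
    0#                                         ∎
    where open ≡-Reasoning

  addConst : F → Poly → Poly
  addConst c []      = c ∷ []
  addConst c (e ∷ f) = c + e ∷ f

  taylor-addConst-zero : ∀ c f s → taylor (addConst c f) s 0 ≡ c + taylor f s 0
  taylor-addConst-zero c [] s = cong (c +_) (zeroʳ s)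
  taylor-addConst-zero c (e ∷ f) s = +-assoc _ _ _

  taylor-addConst-suc : ∀ c f s l → taylor (addConst c f) s (suc l) ≡ taylor f s (suc l)
  taylor-addConst-suc c [] s l = solve 1 (λ s → s :* con (pos 0) :+ con (pos 0) := con (pos 0)) ≡.refl s
  taylor-addConst-suc c (e ∷ f) s l = ≡.refl

  length-addConst : ∀ {n} c f → length f ≤ suc n → length (addConst c f) ≤ suc n
  length-addConst c [] _ = s≤s z≤n
  length-addConst c (e ∷ f) len = len

  infixl 6 _⊕_
  _⊕_ : Poly → Poly → Poly
  []      ⊕ g       = g
  (c ∷ f) ⊕ []      = c ∷ f
  (c ∷ f) ⊕ (e ∷ g) = c + e ∷ f ⊕ g

  taylor-⊕ : ∀ f g s l → taylor (f ⊕ g) s l ≡ taylor f s l + taylor g s l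
  taylor-⊕ [] g s l = sym (+-identityˡ _)
  taylor-⊕ (c ∷ f) [] s l = sym (+-identityʳ _)
  taylor-⊕ (c ∷ f) (e ∷ g) s zero = ≡.trans (cong (λ t → (c + e) + s * t) (taylor-⊕ f g s 0))
    (solve 5 (λ c e s a b → (c :+ e) :+ s :* (a :+ b) := (c :+ s :* a) :+ (e :+ s :* b)) ≡.refl c e s (taylor f s 0) (taylor g s 0))
  taylor-⊕ (c ∷ f) (e ∷ g) s (suc l) = ≡.trans (cong₂ (λ t u → s * t + u) (taylor-⊕ f g s (suc l)) (taylor-⊕ f g s l))
    (solve 5 (λ s a b c d → s :* (a :+ b) :+ (c :+ d) := (s :* a :+ c) :+ (s :* b :+ d)) ≡.refl
      s (taylor f s (suc l)) (taylor g s (suc l)) (taylor f s l) (taylor g s l))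

  length-⊕ : ∀ {n} f g → length f ≤ n → length g ≤ n → length (f ⊕ g) ≤ n
  length-⊕ [] g _ len = len
  length-⊕ (c ∷ f) [] len _ = len
  length-⊕ (c ∷ f) (e ∷ g) (s≤s len) (s≤s len′) = s≤s (length-⊕ f g len len′)

  [x-_] : F → Poly → Poly
  [x- e ] []      = []
  [x- e ] (c ∷ f) = - e * c ∷ addConst c ([x- e ] f)

  taylor-[x-]-zero : ∀ e f s → taylor ([x- e ] f) s 0 ≡ (s - e) * taylor f s 0
  taylor-[x-]-zero e [] s = sym (zeroʳ _)
  taylor-[x-]-zero e (c ∷ f) s = begin
    - e * c + s * taylor (addConst c ([x- e ] f)) s 0   ≡⟨ cong (λ t → - e * c + s * t) (taylor-addConst-zero c ([x- e ] f) s) ⟩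
    - e * c + s * (c + taylor ([x- e ] f) s 0)          ≡⟨ cong (λ t → - e * c + s * (c + t)) (taylor-[x-]-zero e f s) ⟩
    - e * c + s * (c + (s - e) * taylor f s 0)          ≡⟨ solve 4 (λ e c s t → :- e :* c :+ s :* (c :+ (s :- e) :* t) := (s :- e) :* (c :+ s :* t)) ≡.refl e c s (taylor f s 0) ⟩
    (s - e) * (c + s * taylor f s 0)                    ∎
    where open ≡-Reasoning

  taylor-[x-]-suc : ∀ e f s l → taylor ([x- e ] f) s (suc l) ≡ (s - e) * taylor f s (suc l) + taylor f s l
  taylor-[x-]-suc e [] s l = solve 2 (λ e s → con (pos 0) := (s :- e) :* con (pos 0) :+ con (pos 0)) ≡.refl e s
  taylor-[x-]-suc e (c ∷ f) s zero = begin
    s * taylor (addConst c ([x- e ] f)) s 1 + taylor (addConst c ([x- e ] f)) s 0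
      ≡⟨ cong₂ (λ t u → s * t + u) (taylor-addConst-suc c ([x- e ] f) s 0) (taylor-addConst-zero c ([x- e ] f) s) ⟩
    s * taylor ([x- e ] f) s 1 + (c + taylor ([x- e ] f) s 0)
      ≡⟨ cong₂ (λ t u → s * t + (c + u)) (taylor-[x-]-suc e f s 0) (taylor-[x-]-zero e f s) ⟩
    s * ((s - e) * taylor f s 1 + taylor f s 0) + (c + (s - e) * taylor f s 0)
      ≡⟨ solve 5 (λ e c s t u → s :* ((s :- e) :* t :+ u) :+ (c :+ (s :- e) :* u) := (s :- e) :* (s :* t :+ u) :+ (c :+ s :* u)) ≡.refl
           e c s (taylor f s 1) (taylor f s 0) ⟩
    (s - e) * (s * taylor f s 1 + taylor f s 0) + (c + s * taylor f s 0) ∎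
    where open ≡-Reasoning
  taylor-[x-]-suc e (c ∷ f) s (suc l) = begin
    s * taylor (addConst c ([x- e ] f)) s (2 ℕ.+ l) + taylor (addConst c ([x- e ] f)) s (suc l)
      ≡⟨ cong₂ (λ t u → s * t + u) (taylor-addConst-suc c ([x- e ] f) s (suc l)) (taylor-addConst-suc c ([x- e ] f) s l) ⟩
    s * taylor ([x- e ] f) s (2 ℕ.+ l) + taylor ([x- e ] f) s (suc l)
      ≡⟨ cong₂ (λ t u → s * t + u) (taylor-[x-]-suc e f s (suc l)) (taylor-[x-]-suc e f s l) ⟩
    s * ((s - e) * t₂ + t₁) + ((s - e) * t₁ + t₀)
      ≡⟨ solve 5 (λ e s t₂ t₁ t₀ → s :* ((s :- e) :* t₂ :+ t₁) :+ ((s :- e) :* t₁ :+ t₀)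
           := (s :- e) :* (s :* t₂ :+ t₁) :+ (s :* t₁ :+ t₀)) ≡.refl e s t₂ t₁ t₀ ⟩
    (s - e) * (s * t₂ + t₁) + (s * t₁ + t₀) ∎
    where
    open ≡-Reasoning
    t₂ = taylor f s (2 ℕ.+ l)
    t₁ = taylor f s (suc l)
    t₀ = taylor f s l

  length-[x-] : ∀ {n} e f → length f ≤ n → length ([x- e ] f) ≤ suc n
  length-[x-] e [] _ = z≤n
  length-[x-] e (c ∷ f) (s≤s len) = s≤s (length-addConst c ([x- e ] f) (length-[x-] e f len))

  -- H E j is h (x - e₁ , x - e₂ , …) j as a polynomial in x, for E = e₁ ∷ e₂ ∷ ….
  H : List F → ℕ → Poly
  H []      zero    = 1# ∷ []
  H []      (suc j) = []
  H (e ∷ E) zero    = 1# ∷ []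
  H (e ∷ E) (suc j) = H E (suc j) ⊕ [x- e ] (H (e ∷ E) j)

  length-H : ∀ E j → length (H E j) ≤ suc j
  length-H [] zero = s≤s z≤n
  length-H [] (suc j) = z≤n
  length-H (e ∷ E) zero = s≤s z≤n
  length-H (e ∷ E) (suc j) = length-⊕ (H E (suc j)) _ (length-H E (suc j)) (length-[x-] e (H (e ∷ E) j) (length-H (e ∷ E) j))

  differences : F → List F → List F
  differences s E = map (λ e → s - e) E

  -- Substitute x = s + u and write y = s - e. Since 1 - (y + u) t = (1 - u t) (1 - y t / (1 - u
  -- t)), the generating function for m points is ∑ᵢ hᵢ tⁱ (1 - u t) ^ (- (m + i)). With i = j - l,
  -- the coefficient of u ^ l t ^ l in the last factor is C(j + m - 1, l).
  taylor-H : ∀ e E s j l → l ≤ j →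
    taylor (H (e ∷ E) j) s l ≡ binom (j ℕ.+ length E) l * h (differences s (e ∷ E)) (j ∸ l)
  private
    -- The binomial coefficient depends only on the degree plus the number of points, so dropping a
    -- point and raising the degree leaves it unchanged. The empty list is included: there both
    -- sides vanish.
    taylor-H-tail : ∀ E s j l → l ≤ suc j →
      taylor (H E (suc j)) s l ≡ binom (j ℕ.+ length E) l * h (differences s E) (suc j ∸ l)

  taylor-H e E s zero zero _ = solve 1 (λ s → con (pos 1) :+ s :* con (pos 0) := con (pos 1) :* con (pos 1)) ≡.refl s
  taylor-H e E s (suc j) zero _ = begin
    taylor (H E (suc j) ⊕ [x- e ] (H (e ∷ E) j)) s 0     ≡⟨ taylor-⊕ (H E (suc j)) _ s 0 ⟩
    taylor (H E (suc j)) s 0 + taylor ([x- e ] (H (e ∷ E) j)) s 0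
      ≡⟨ cong₂ _+_ (taylor-H-tail E s j 0 z≤n) (≡.trans (taylor-[x-]-zero e (H (e ∷ E) j) s) (cong ((s - e) *_) (taylor-H e E s j 0 z≤n))) ⟩
    1# * h (differences s E) (suc j) + (s - e) * (1# * h (differences s (e ∷ E)) j)
      ≡⟨ solve 3 (λ a b c → con (pos 1) :* a :+ c :* (con (pos 1) :* b) := con (pos 1) :* (a :+ c :* b)) ≡.refl
           (h (differences s E) (suc j)) (h (differences s (e ∷ E)) j) (s - e) ⟩
    1# * h (differences s (e ∷ E)) (suc j) ∎
    where open ≡-Reasoning
  taylor-H e E s (suc j) (suc l) (s≤s l≤j) = begin
    taylor (H E (suc j) ⊕ [x- e ] (H (e ∷ E) j)) s (suc l)     ≡⟨ taylor-⊕ (H E (suc j)) _ s (suc l) ⟩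
    taylor (H E (suc j)) s (suc l) + taylor ([x- e ] (H (e ∷ E) j)) s (suc l)
      ≡⟨ cong₂ _+_ (taylor-H-tail E s j (suc l) (s≤s l≤j))
           (≡.trans (taylor-[x-]-suc e (H (e ∷ E) j) s l) (cong ((s - e) * taylor (H (e ∷ E) j) s (suc l) +_) (taylor-H e E s j l l≤j))) ⟩
    b * h (differences s E) (j ∸ l) + ((s - e) * taylor (H (e ∷ E) j) s (suc l) + a * hⱼ₋ₗ)
      ≡⟨ +-assoc _ _ _ ⟨
    (b * h (differences s E) (j ∸ l) + (s - e) * taylor (H (e ∷ E) j) s (suc l)) + a * hⱼ₋ₗ
      ≡⟨ cong (_+ a * hⱼ₋ₗ) (step (ℕₚ.≤⇒≤′ l≤j)) ⟩
    b * hⱼ₋ₗ + a * hⱼ₋ₗ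
      ≡⟨ solve 3 (λ a b x → b :* x :+ a :* x := (a :+ b) :* x) ≡.refl a b hⱼ₋ₗ ⟩
    (a + b) * hⱼ₋ₗ
      ≡⟨ cong (_* hⱼ₋ₗ) (pascal (j ℕ.+ length E) l) ⟨
    binom (suc (j ℕ.+ length E)) (suc l) * hⱼ₋ₗ ∎
    where
    open ≡-Reasoning
    a = binom (j ℕ.+ length E) l
    b = binom (j ℕ.+ length E) (suc l)
    hⱼ₋ₗ = h (differences s (e ∷ E)) (j ∸ l)
    -- For `l = j` the coefficient of order `suc l` lies beyond the degree of the polynomial and
    -- must be treated apart from the inductive formula.
    step : l ℕ.≤′ j → b * h (differences s E) (j ∸ l) + (s - e) * taylor (H (e ∷ E) j) s (suc l) ≡ b * hⱼ₋ₗ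
    step ℕ.≤′-refl = begin
      b * h (differences s E) (j ∸ j) + (s - e) * taylor (H (e ∷ E) j) s (suc j)
        ≡⟨ cong₂ (λ t u → b * t + (s - e) * u) (≡.trans (cong (h (differences s E)) (ℕₚ.n∸n≡0 j)) (h-zero (differences s E)))
             (taylor-length≤ (H (e ∷ E) j) s (suc j) (length-H (e ∷ E) j)) ⟩
      b * 1# + (s - e) * 0#
        ≡⟨ solve 2 (λ b c → b :* con (pos 1) :+ c :* con (pos 0) := b :* con (pos 1)) ≡.refl b (s - e) ⟩
      b * 1#
        ≡⟨ cong (λ k → b * h (differences s (e ∷ E)) k) (ℕₚ.n∸n≡0 j) ⟨
      b * h (differences s (e ∷ E)) (j ∸ j) ∎
    step (ℕ.≤′-step {j′} l≤′j′) = begin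
      b * h (differences s E) (suc j′ ∸ l) + (s - e) * taylor (H (e ∷ E) (suc j′)) s (suc l)
        ≡⟨ cong₂ (λ k t → b * h (differences s E) k + (s - e) * t) (ℕₚ.+-∸-assoc 1 (ℕₚ.≤′⇒≤ l≤′j′)) (taylor-H e E s (suc j′) (suc l) (s≤s (ℕₚ.≤′⇒≤ l≤′j′))) ⟩
      b * h (differences s E) (suc (j′ ∸ l)) + (s - e) * (b * h (differences s (e ∷ E)) (j′ ∸ l))
        ≡⟨ solve 4 (λ b x c y → b :* x :+ c :* (b :* y) := b :* (x :+ c :* y)) ≡.refl b (h (differences s E) (suc (j′ ∸ l))) (s - e) (h (differences s (e ∷ E)) (j′ ∸ l)) ⟩
      b * h (differences s (e ∷ E)) (suc (j′ ∸ l))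
        ≡⟨ cong (λ k → b * h (differences s (e ∷ E)) k) (ℕₚ.+-∸-assoc 1 (ℕₚ.≤′⇒≤ l≤′j′)) ⟨
      b * h (differences s (e ∷ E)) (suc j′ ∸ l) ∎

  taylor-H-tail [] s j l l≤ = sym (tail-zero l l≤)
    where
    tail-zero : ∀ l → l ≤ suc j → binom (j ℕ.+ 0) l * h [] (suc j ∸ l) ≡ 0#
    tail-zero l l≤ with ℕₚ.m≤n⇒m<n∨m≡n l≤
    ... | inj₂ ≡.refl = ≡.trans (cong (_* h [] (suc j ∸ suc j)) (binom-> (s≤s (ℕₚ.≤-reflexive (ℕₚ.+-identityʳ j))))) (zeroˡ _)
    ... | inj₁ (s≤s l≤j) = ≡.trans (cong (λ k → binom (j ℕ.+ 0) l * h [] k) (ℕₚ.+-∸-assoc 1 l≤j)) (zeroʳ _)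
  taylor-H-tail (e ∷ E) s j l l≤ =
    subst (λ n → taylor (H (e ∷ E) (suc j)) s l ≡ binom n l * h (differences s (e ∷ E)) (suc j ∸ l)) (sym (ℕₚ.+-suc j (length E)))
      (taylor-H e E s (suc j) l l≤)

  -- Division by linear factors and zeros of high order

  -- Synthetic division by `x - s`; the remainder is `taylor f s 0`.
  quot : F → Poly → Poly
  quot s []          = []
  quot s (c ∷ [])    = []
  quot s (c ∷ e ∷ f) = taylor (e ∷ f) s 0 ∷ quot s (e ∷ f)

  length-quot : ∀ s f → length (quot s f) ≡ length f ∸ 1
  length-quot s [] = ≡.refl
  length-quot s (c ∷ []) = ≡.refl
  length-quot s (c ∷ e ∷ f) = cong suc (length-quot s (e ∷ f))

  taylor-quot-zero : ∀ s f r → taylor f r 0 ≡ taylor f s 0 + (r - s) * taylor (quot s f) r 0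
  taylor-quot-zero s [] r = solve 2 (λ r s → con (pos 0) := con (pos 0) :+ (r :- s) :* con (pos 0)) ≡.refl r s
  taylor-quot-zero s (c ∷ []) r = solve 3 (λ c r s → c :+ r :* con (pos 0) := (c :+ s :* con (pos 0)) :+ (r :- s) :* con (pos 0)) ≡.refl c r s
  taylor-quot-zero s (c ∷ f@(_ ∷ _)) r = ≡.trans (cong (λ t → c + r * t) (taylor-quot-zero s f r))
    (solve 5 (λ c r s a b → c :+ r :* (a :+ (r :- s) :* b) := (c :+ s :* a) :+ (r :- s) :* (a :+ r :* b)) ≡.refl
      c r s (taylor f s 0) (taylor (quot s f) r 0))

  taylor-quot-suc : ∀ s f r l → taylor f r (suc l) ≡ (r - s) * taylor (quot s f) r (suc l) + taylor (quot s f) r l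
  taylor-quot-suc s [] r l = solve 2 (λ r s → con (pos 0) := (r :- s) :* con (pos 0) :+ con (pos 0)) ≡.refl r s
  taylor-quot-suc s (c ∷ []) r zero = solve 2 (λ r s → r :* con (pos 0) :+ con (pos 0) := (r :- s) :* con (pos 0) :+ con (pos 0)) ≡.refl r s
  taylor-quot-suc s (c ∷ []) r (suc l) = solve 2 (λ r s → r :* con (pos 0) :+ con (pos 0) := (r :- s) :* con (pos 0) :+ con (pos 0)) ≡.refl r s
  taylor-quot-suc s (c ∷ f@(_ ∷ _)) r zero = ≡.trans
    (cong₂ (λ t u → r * t + u) (taylor-quot-suc s f r 0) (taylor-quot-zero s f r))
    (solve 5 (λ r s a b c → r :* ((r :- s) :* a :+ b) :+ (c :+ (r :- s) :* b) := (r :- s) :* (r :* a :+ b) :+ (c :+ r :* b)) ≡.refl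
      r s (taylor (quot s f) r 1) (taylor (quot s f) r 0) (taylor f s 0))
  taylor-quot-suc s (c ∷ f@(_ ∷ _)) r (suc l) = ≡.trans
    (cong₂ (λ t u → r * t + u) (taylor-quot-suc s f r (suc l)) (taylor-quot-suc s f r l))
    (solve 5 (λ r s a b c → r :* ((r :- s) :* a :+ b) :+ ((r :- s) :* b :+ c) := (r :- s) :* (r :* a :+ b) :+ (r :* b :+ c)) ≡.refl
      r s (taylor (quot s f) r (2 ℕ.+ l)) (taylor (quot s f) r (suc l)) (taylor (quot s f) r l))

  VanishesToOrder : Poly → ℕ → F → Set
  VanishesToOrder f k s = ∀ l → l < k → taylor f s l ≡ 0#

  taylor-quot-same : ∀ s f l → taylor (quot s f) s l ≡ taylor f s (suc l)
  taylor-quot-same s f l = sym (≡.trans (taylor-quot-suc s f s l)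
    (solve 3 (λ s a b → (s :- s) :* a :+ b := b) ≡.refl s (taylor (quot s f) s (suc l)) (taylor (quot s f) s l)))

  quot-vanishes-same : ∀ {s f k} → VanishesToOrder f (suc k) s → VanishesToOrder (quot s f) k s
  quot-vanishes-same {s} {f} van l l<k = ≡.trans (taylor-quot-same s f l) (van (suc l) (s≤s l<k))

  -- The recurrence `taylor-quot-suc` determines the coefficients at `r` one after the other,
  -- because `r - s` can be cancelled.
  quot-vanishes-other : ∀ {s f k r} → taylor f s 0 ≡ 0# → r ≢ s → VanishesToOrder f k r → VanishesToOrder (quot s f) k r
  quot-vanishes-other {s} {f} {k} {r} fs≡0 r≢s van zero l<k = xy≡0⇒y≡0 (x≢y⇒x-y≢0 r≢s) (begin
    (r - s) * taylor (quot s f) r 0                   ≡⟨ +-identityˡ _ ⟨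
    0# + (r - s) * taylor (quot s f) r 0              ≡⟨ cong (_+ (r - s) * taylor (quot s f) r 0) fs≡0 ⟨
    taylor f s 0 + (r - s) * taylor (quot s f) r 0    ≡⟨ taylor-quot-zero s f r ⟨
    taylor f r 0                                      ≡⟨ van 0 l<k ⟩
    0#                                                ∎)
    where open ≡-Reasoning
  quot-vanishes-other {s} {f} {k} {r} fs≡0 r≢s van (suc l) l<k = xy≡0⇒y≡0 (x≢y⇒x-y≢0 r≢s) (begin
    (r - s) * taylor (quot s f) r (suc l)                             ≡⟨ +-identityʳ _ ⟨
    (r - s) * taylor (quot s f) r (suc l) + 0#                        ≡⟨ cong ((r - s) * taylor (quot s f) r (suc l) +_) (quot-vanishes-other {f = f} fs≡0 r≢s van l (ℕₚ.<-trans (ℕₚ.n<1+n l) l<k)) ⟨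
    (r - s) * taylor (quot s f) r (suc l) + taylor (quot s f) r l     ≡⟨ taylor-quot-suc s f r l ⟨
    taylor f r (suc l)                                                ≡⟨ van (suc l) l<k ⟩
    0#                                                                ∎)
    where open ≡-Reasoning

  -- Records f = cofactor · u up to first order at s₀, where u has value scale and logarithmic
  -- derivative σ at s₀, and cofactor has n coefficients fewer than f.
  record Cofactor (s₀ : F) (f : Poly) (σ : F) (n : ℕ) : Set where
    field
      cofactor : Poly
      scale    : F
      length≤  : length cofactor ≤ length f ∸ n
      zeroth   : taylor f s₀ 0 ≡ scale * taylor cofactor s₀ 0
      first    : taylor f s₀ 1 ≡ scale * (taylor cofactor s₀ 1 + σ * taylor cofactor s₀ 0)

  -- Logarithmic derivatives add, and the factor `x - s` contributes 1 / (s₀ - s). The identities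
  -- stay in multiplied form because the cofactor may vanish at `s₀`.
  divide-root : ∀ {s₀ s f σ n} → s₀ ≢ s → taylor f s 0 ≡ 0# → Cofactor s₀ (quot s f) σ n →
    Cofactor s₀ f (inv (s₀ - s) + σ) (suc n)
  divide-root {s₀} {s} {f} {σ} {n} s₀≢s fs≡0 c = record
    { cofactor = g
    ; scale    = (s₀ - s) * k
    ; length≤  = ℕₚ.≤-trans length≤ (ℕₚ.≤-reflexive (≡.trans (cong (_∸ n) (length-quot s f)) (ℕₚ.∸-+-assoc (length f) 1 n)))
    ; zeroth   = begin
        taylor f s₀ 0                                           ≡⟨ zeroth′ ⟩
        (s₀ - s) * taylor (quot s f) s₀ 0                       ≡⟨ cong ((s₀ - s) *_) zeroth ⟩
        (s₀ - s) * (k * g₀)                                     ≡⟨ *-assoc _ _ _ ⟨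
        ((s₀ - s) * k) * g₀                                     ∎
    ; first    = begin
        taylor f s₀ 1                                           ≡⟨ taylor-quot-suc s f s₀ 0 ⟩
        (s₀ - s) * taylor (quot s f) s₀ 1 + taylor (quot s f) s₀ 0
          ≡⟨ cong₂ (λ t u → (s₀ - s) * t + u) first (≡.trans zeroth (sym (*-identityˡ _))) ⟩
        (s₀ - s) * (k * (g₁ + σ * g₀)) + 1# * (k * g₀)
          ≡⟨ cong (λ t → (s₀ - s) * (k * (g₁ + σ * g₀)) + t * (k * g₀)) (*-inv (x≢y⇒x-y≢0 s₀≢s)) ⟨
        (s₀ - s) * (k * (g₁ + σ * g₀)) + ((s₀ - s) * inv (s₀ - s)) * (k * g₀)
          ≡⟨ solve 6 (λ d k a s b i → d :* (k :* (a :+ s :* b)) :+ (d :* i) :* (k :* b) := (d :* k) :* (a :+ (i :+ s) :* b)) ≡.refl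
               (s₀ - s) k g₁ σ g₀ (inv (s₀ - s)) ⟩
        ((s₀ - s) * k) * (g₁ + (inv (s₀ - s) + σ) * g₀)         ∎
    }
    where
    open ≡-Reasoning
    open Cofactor c renaming (cofactor to g; scale to k)
    g₀ = taylor g s₀ 0
    g₁ = taylor g s₀ 1
    zeroth′ : taylor f s₀ 0 ≡ (s₀ - s) * taylor (quot s f) s₀ 0
    zeroth′ = ≡.trans (taylor-quot-zero s f s₀) (≡.trans (cong (_+ (s₀ - s) * taylor (quot s f) s₀ 0) fs≡0) (+-identityˡ _))

  divide-roots : ∀ {s₀} m S → Unique S → All (s₀ ≢_) S → ∀ f → All (VanishesToOrder f m) S →
    Cofactor s₀ f (ι m * ∑ S (λ s → inv (s₀ - s))) (length S ℕ.* m)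
  divide-roots {s₀} m [] _ _ f _ = record
    { cofactor = f
    ; scale    = 1#
    ; length≤  = ℕₚ.≤-refl
    ; zeroth   = sym (*-identityˡ _)
    ; first    = solve 3 (λ m a b → a := con (pos 1) :* (a :+ (m :* con (pos 0)) :* b)) ≡.refl (ι m) (taylor f s₀ 1) (taylor f s₀ 0)
    }
  divide-roots {s₀} m (s ∷ S) (s∉ ∷ S!) (s₀≢s ∷ s₀∉) f (van ∷ vans) = subst (λ σ → Cofactor s₀ f σ (m ℕ.+ length S ℕ.* m))
    (solve 3 (λ m i t → m :* i :+ m :* t := m :* (i :+ t)) ≡.refl (ι m) (inv (s₀ - s)) (∑ S (λ s → inv (s₀ - s))))
    (at m f van vans)
    where
    rest : F
    rest = ι m * ∑ S (λ s → inv (s₀ - s))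
    -- `k` divisions by `x - s` are still due; each of them preserves the order `m` at the remaining
    -- points.
    at : ∀ k f → VanishesToOrder f k s → All (VanishesToOrder f m) S →
      Cofactor s₀ f (ι k * inv (s₀ - s) + rest) (k ℕ.+ length S ℕ.* m)
    at zero f van vans = subst (λ σ → Cofactor s₀ f σ (length S ℕ.* m))
      (solve 2 (λ i t → t := con (pos 0) :* i :+ t) ≡.refl (inv (s₀ - s)) rest) (divide-roots m S S! s₀∉ f vans)
    at (suc k) f van vans = subst (λ σ → Cofactor s₀ f σ (suc k ℕ.+ length S ℕ.* m))
      (≡.trans (solve 3 (λ i k t → i :+ (k :* i :+ t) := (con (pos 1) :+ k) :* i :+ t) ≡.refl (inv (s₀ - s)) (ι k) rest)
        (cong (λ t → t * inv (s₀ - s) + rest) (sym (ι-suc k))))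
      (divide-root {f = f} s₀≢s fs≡0 (at k (quot s f) (quot-vanishes-same {f = f} van)
        (All.zipWith (λ (s≢r , van) → quot-vanishes-other {f = f} fs≡0 (λ r≡s → s≢r (sym r≡s)) van) (s∉ , vans))))
      where
      fs≡0 : taylor f s 0 ≡ 0#
      fs≡0 = van 0 (s≤s z≤n)

  -- Moves the Taylor coefficients of orders `k` and `k + 1` at `s₀` down to orders 0 and 1, the two
  -- that `Cofactor` records.
  divide-power : ∀ {s₀ m} S → All (s₀ ≢_) S → ∀ k f → VanishesToOrder f k s₀ → All (VanishesToOrder f m) S →
    ∃ λ g → length g ≡ length f ∸ k × All (VanishesToOrder g m) S × (∀ l → taylor g s₀ l ≡ taylor f s₀ (l ℕ.+ k))
  divide-power S s₀∉ zero f _ vans = f , ≡.refl , vans , λ l → cong (taylor f _) (sym (ℕₚ.+-identityʳ l))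
  divide-power {s₀} S s₀∉ (suc k) f van vans
    with g , len , vans′ , eq ← divide-power S s₀∉ k (quot s₀ f) (quot-vanishes-same {f = f} van)
           (All.zipWith (λ (s₀≢r , van′) → quot-vanishes-other {f = f} (van 0 (s≤s z≤n)) (λ r≡s → s₀≢r (sym r≡s)) van′) (s₀∉ , vans))
    = g
    , ≡.trans len (≡.trans (cong (_∸ k) (length-quot s₀ f)) (ℕₚ.∸-+-assoc (length f) 1 k))
    , vans′
    , λ l → ≡.trans (eq l) (≡.trans (taylor-quot-same s₀ f (l ℕ.+ k)) (cong (taylor f s₀) (sym (ℕₚ.+-suc l k))))

  module _ {s₀ : F} {S : List F} (S! : Unique (s₀ ∷ S)) {m : ℕ} (f : Poly) (vans : All (VanishesToOrder f m) (s₀ ∷ S)) where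

    -- Both are statements about f / (x - s₀) ^ m, whose zeros of order m at S leave it at most one coefficient.
    many-roots⇒≡0 : length f ≤ length (s₀ ∷ S) ℕ.* m → taylor f s₀ m ≡ 0#
    logarithmic-derivative : length f ≤ suc (length (s₀ ∷ S) ℕ.* m) →
      taylor f s₀ (suc m) ≡ ι m * ∑ S (λ s → inv (s₀ - s)) * taylor f s₀ m

    private
      divided : ∃ λ g → length g ≡ length f ∸ m × All (VanishesToOrder g m) S × (∀ l → taylor g s₀ l ≡ taylor f s₀ (l ℕ.+ m))
      divided = divide-power S (AllPairs.head S!) m f (All.head vans) (All.tail vans)

      g : Poly
      g = proj₁ divided

      taylor-g : ∀ l → taylor g s₀ l ≡ taylor f s₀ (l ℕ.+ m)
      taylor-g = proj₂ (proj₂ (proj₂ divided))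

      cofactor-g : Cofactor s₀ g (ι m * ∑ S (λ s → inv (s₀ - s))) (length S ℕ.* m)
      cofactor-g = divide-roots m S (AllPairs.tail S!) (AllPairs.head S!) g (proj₁ (proj₂ (proj₂ divided)))

      open Cofactor cofactor-g

      length-cofactor : length cofactor ≤ length f ∸ length (s₀ ∷ S) ℕ.* m
      length-cofactor = ℕₚ.≤-trans length≤ (ℕₚ.≤-reflexive
        (≡.trans (cong (_∸ length S ℕ.* m) (proj₁ (proj₂ divided))) (ℕₚ.∸-+-assoc (length f) m (length S ℕ.* m))))

    many-roots⇒≡0 len = begin
      taylor f s₀ m                       ≡⟨ taylor-g 0 ⟨
      taylor g s₀ 0                       ≡⟨ zeroth ⟩
      scale * taylor cofactor s₀ 0        ≡⟨ cong (scale *_) (taylor-length≤ cofactor s₀ 0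
                                               (ℕₚ.≤-trans length-cofactor (ℕₚ.≤-reflexive (ℕₚ.m≤n⇒m∸n≡0 len)))) ⟩
      scale * 0#                          ≡⟨ zeroʳ _ ⟩
      0#                                  ∎
      where open ≡-Reasoning

    logarithmic-derivative len = begin
      taylor f s₀ (suc m)                                             ≡⟨ taylor-g 1 ⟨
      taylor g s₀ 1                                                   ≡⟨ first ⟩
      scale * (taylor cofactor s₀ 1 + σ * taylor cofactor s₀ 0)       ≡⟨ cong (λ t → scale * (t + σ * taylor cofactor s₀ 0)) (taylor-length≤ cofactor s₀ 1
                                                                           (ℕₚ.≤-trans length-cofactor (ℕₚ.m≤n+o⇒m∸n≤o _ _ (ℕₚ.≤-trans len (ℕₚ.≤-reflexive (ℕₚ.+-comm 1 _)))))) ⟩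
      scale * (0# + σ * taylor cofactor s₀ 0)                         ≡⟨ solve 3 (λ k s c → k :* (con (pos 0) :+ s :* c) := s :* (k :* c)) ≡.refl scale σ (taylor cofactor s₀ 0) ⟩
      σ * (scale * taylor cofactor s₀ 0)                              ≡⟨ cong (σ *_) (≡.trans (sym zeroth) (taylor-g 0)) ⟩
      σ * taylor f s₀ m                                               ∎
      where
      open ≡-Reasoning
      σ = ι m * ∑ S (λ s → inv (s₀ - s))

  -- Stepanov's bound and the electrostatic equations

  -- H E d - η vanishes to order |E| at every point of S; its degree is at most d.
  module Stepanov {e s : F} {E S : List F} (E! : Unique (e ∷ E)) (S! : Unique (s ∷ S))
    {d : ℕ} {η : F} (0<d : 0 < d) (η≢0 : η ≢ 0#)
    (roots : ∀ {y x} → y ∈ s ∷ S → x ∈ e ∷ E → (y - x) ^ d ≡ η)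
    (E≤d : length (e ∷ E) ≤ d) (d+E<p : d ℕ.+ length E < p) where

    private
      m : ℕ
      m = length (e ∷ E)

      f : Poly
      f = addConst (- η) (H (e ∷ E) d)

      length-f : length f ≤ suc d
      length-f = length-addConst (- η) (H (e ∷ E) d) (length-H (e ∷ E) d)

      unique : ∀ y → Unique (differences y (e ∷ E))
      unique y = Uniqueₚ.map⁺ (λ {x} {x′} eq → begin
        x                  ≡⟨ solve 2 (λ y x → x := y :- (y :- x)) ≡.refl y x ⟩
        y - (y - x)        ≡⟨ cong (λ t → y - t) eq ⟩
        y - (y - x′)       ≡⟨ solve 2 (λ y x → y :- (y :- x) := x) ≡.refl y x′ ⟩
        x′                 ∎) E!
        where open ≡-Reasoning

      all-roots : ∀ {y} → y ∈ s ∷ S → All (IsRoot 0<d η≢0) (differences y (e ∷ E))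
      all-roots y∈S = Allₚ.map⁺ (All.tabulate (roots y∈S))

      length-differences : ∀ y → length (differences y E) ≡ length E
      length-differences y = length-map _ E

      vanishes : ∀ {y} → y ∈ s ∷ S → VanishesToOrder f m y
      vanishes {y} y∈S zero _ = begin
        taylor f y 0                                              ≡⟨ taylor-addConst-zero (- η) (H (e ∷ E) d) y ⟩
        - η + taylor (H (e ∷ E) d) y 0                            ≡⟨ cong (- η +_) (taylor-H e E y d 0 z≤n) ⟩
        - η + 1# * h (differences y (e ∷ E)) d                    ≡⟨ cong (λ t → - η + 1# * t) (h-degree 0<d η≢0 _ _ (unique y) (all-roots y∈S)) ⟩
        - η + 1# * η                                              ≡⟨ solve 1 (λ x → :- x :+ con (pos 1) :* x := con (pos 0)) ≡.refl η ⟩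
        0#                                                        ∎
        where open ≡-Reasoning
      vanishes {y} y∈S (suc l) (s≤s l<) = begin
        taylor f y (suc l)                                        ≡⟨ taylor-addConst-suc (- η) (H (e ∷ E) d) y l ⟩
        taylor (H (e ∷ E) d) y (suc l)                            ≡⟨ taylor-H e E y d (suc l) l<d ⟩
        b * h (differences y (e ∷ E)) (d ∸ suc l)                 ≡⟨ cong (b *_) (h-gap 0<d η≢0 _ _ (unique y) (all-roots y∈S) l (d ∸ suc l)
                                                                       (ℕₚ.<-≤-trans l< (ℕₚ.≤-reflexive (sym (length-differences y)))) (ℕₚ.m∸n+n≡m l<d)) ⟩
        b * 0#                                                    ≡⟨ zeroʳ b ⟩
        0#                                                        ∎
        where
        open ≡-Reasoning
        b = binom (d ℕ.+ length E) (suc l)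
        l<d : suc l ≤ d
        l<d = ℕₚ.≤-trans (ℕₚ.m≤n⇒m≤1+n l<) E≤d

      vans : All (VanishesToOrder f m) (s ∷ S)
      vans = All.tabulate vanishes

      h-top : h (differences s (e ∷ E)) (d ∸ m) ≢ 0#
      h-top = h-top≢0 0<d η≢0 _ _ (unique s) (all-roots (here ≡.refl)) (d ∸ m)
        (≡.trans (cong (λ k → d ∸ m ℕ.+ suc k) (length-differences s)) (ℕₚ.m∸n+n≡m E≤d))

      taylor-m : taylor f s m ≡ binom (d ℕ.+ length E) m * h (differences s (e ∷ E)) (d ∸ m)
      taylor-m = ≡.trans (taylor-addConst-suc (- η) (H (e ∷ E) d) s (length E)) (taylor-H e E s d m E≤d)

      binom-m≢0 : binom (d ℕ.+ length E) m ≢ 0#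
      binom-m≢0 = binom≢0 d+E<p m (ℕₚ.+-monoˡ-≤ (length E) {1} 0<d)

    -- The Taylor coefficient of order `m` at `s` is a nonzero binomial coefficient times the
    -- nonzero `h-top`. If the prescribed zeros outnumbered the degree, `many-roots⇒≡0` would make
    -- it vanish.
    length*length≤d : length (s ∷ S) ℕ.* length (e ∷ E) ≤ d
    length*length≤d with length (s ∷ S) ℕ.* m ℕₚ.≤? d
    ... | yes ≤d = ≤d
    ... | no ≰d = contradiction (≡.trans (sym taylor-m) (many-roots⇒≡0 S! f vans (ℕₚ.≤-trans length-f (ℕₚ.≰⇒> ≰d))))
                    (xy≢0 binom-m≢0 h-top)

    -- Two evaluations of the ratio of the Taylor coefficients of orders m + 1 and m at `s`. By
    -- `taylor-H`, `binom-step` and `h-subtop` it is (d - 1) / (m + 1) times ∑ 1 / (s - x), the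
    -- numerator being (d + m - 1) - m; by `logarithmic-derivative` it is m ∑ 1 / (s - y).
    stieltjes-head : length (s ∷ S) ℕ.* length (e ∷ E) ≡ d → length (e ∷ E) < d →
      (ι d - 1#) * ∑ (e ∷ E) (λ x → inv (s - x)) ≡ (ι m * ι (suc m)) * ∑ S (λ y → inv (s - y))
    stieltjes-head S*E≡d m<d = *-cancelˡ (xy≢0 binom-m≢0 h-top) (begin
      (B * X) * ((ι d - 1#) * I)
        ≡⟨ cong (λ t → (B * X) * (t * I)) N-m ⟨
      (B * X) * ((ι (d ℕ.+ length E) - ι m) * I)
        ≡⟨ solve 4 (λ b x n i → (b :* x) :* (n :* i) := (n :* b) :* (i :* x)) ≡.refl B X (ι (d ℕ.+ length E) - ι m) I ⟩
      ((ι (d ℕ.+ length E) - ι m) * B) * (I * X)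
        ≡⟨ cong₂ _*_ (binom-step (d ℕ.+ length E) m) subtop ⟨
      (ι (suc m) * binom (d ℕ.+ length E) (suc m)) * h (differences s (e ∷ E)) (d ∸ suc m)
        ≡⟨ *-assoc _ _ _ ⟩
      ι (suc m) * (binom (d ℕ.+ length E) (suc m) * h (differences s (e ∷ E)) (d ∸ suc m))
        ≡⟨ cong (ι (suc m) *_) (≡.trans (taylor-addConst-suc (- η) (H (e ∷ E) d) s m) (taylor-H e E s d (suc m) m<d)) ⟨
      ι (suc m) * taylor f s (suc m)
        ≡⟨ cong (ι (suc m) *_) (logarithmic-derivative S! f vans (ℕₚ.≤-trans length-f (ℕₚ.≤-reflexive (cong suc (sym S*E≡d))))) ⟩
      ι (suc m) * (ι m * J * taylor f s m)
        ≡⟨ cong (λ t → ι (suc m) * (ι m * J * t)) taylor-m ⟩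
      ι (suc m) * (ι m * J * (B * X))
        ≡⟨ solve 5 (λ m n j b x → n :* (m :* j :* (b :* x)) := (b :* x) :* ((m :* n) :* j)) ≡.refl (ι m) (ι (suc m)) J B X ⟩
      (B * X) * ((ι m * ι (suc m)) * J) ∎)
      where
      open ≡-Reasoning
      B = binom (d ℕ.+ length E) m
      X = h (differences s (e ∷ E)) (d ∸ m)
      I = ∑ (e ∷ E) (λ x → inv (s - x))
      J = ∑ S (λ y → inv (s - y))
      d-m : suc (d ∸ suc m) ≡ d ∸ m
      d-m = sym (ℕₚ.+-∸-assoc 1 m<d)
      subtop : h (differences s (e ∷ E)) (d ∸ suc m) ≡ I * X
      subtop = ≡.trans (h-subtop 0<d η≢0 _ _ (unique s) (all-roots (here ≡.refl)) (d ∸ suc m)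
          (≡.trans (cong (λ k → suc (d ∸ suc m) ℕ.+ suc k) (length-differences s)) (≡.trans (cong (ℕ._+ m) d-m) (ℕₚ.m∸n+n≡m E≤d))))
        (cong₂ _*_ (∑-map (e ∷ E) (λ x → s - x) inv) (cong (h (differences s (e ∷ E))) d-m))
      N-m : ι (d ℕ.+ length E) - ι m ≡ ι d - 1#
      N-m = ≡.trans (cong₂ _-_ (ι-+ d (length E)) (ι-suc (length E)))
        (solve 2 (λ d k → (d :+ k) :- (con (pos 1) :+ k) := d :- con (pos 1)) ≡.refl (ι d) (ι (length E)))

  stieltjes : ∀ {E S : List F} → Unique E → Unique S → ∀ {d η} → 0 < d → η ≢ 0# →
    (∀ {y x} → y ∈ S → x ∈ E → (y - x) ^ d ≡ η) → 0 < length E → length E < d → d ℕ.+ length E ≤ p →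
    length S ℕ.* length E ≡ d → ∀ {s} → s ∈ S →
    (ι d - 1#) * ∑ E (λ x → inv (s - x)) ≡ (ι (length E) * ι (suc (length E))) * ∑ S (λ y → inv (s - y))
  stieltjes {e ∷ E} {S} E! S! {d} 0<d η≢0 roots 0<E E<d d+E≤p S*E≡d {s} s∈S with S′ , S↭ ← ∈⇒↭∷ s∈S = begin
    (ι d - 1#) * ∑ (e ∷ E) (λ x → inv (s - x))
      ≡⟨ Stepanov.stieltjes-head E! (Unique-resp-↭ S↭ S!) 0<d η≢0 (λ y∈ → roots (∈-resp-↭ (↭-sym S↭) y∈)) (ℕₚ.<⇒≤ E<d)
           (ℕₚ.≤-trans (ℕₚ.≤-reflexive (sym (ℕₚ.+-suc d (length E)))) d+E≤p)
           (≡.trans (cong (ℕ._* length (e ∷ E)) (sym (↭-length S↭))) S*E≡d) E<d ⟩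
    c * ∑ S′ (λ y → inv (s - y))
      ≡⟨ cong (c *_) (+-identityˡ _) ⟨
    -- The inserted `0#` becomes the term `y = s` of the sum over all of `S`.
    c * (0# + ∑ S′ (λ y → inv (s - y)))
      ≡⟨ cong (λ t → c * (t + ∑ S′ (λ y → inv (s - y)))) (inv-0 (-‿inverseʳ s)) ⟨
    c * ∑ (s ∷ S′) (λ y → inv (s - y))
      ≡⟨ cong (c *_) (∑-↭ S↭ (λ y → inv (s - y))) ⟨
    c * ∑ S (λ y → inv (s - y)) ∎
    where
    open ≡-Reasoning
    c = ι (length (e ∷ E)) * ι (suc (length (e ∷ E)))

  length*length≤ : ∀ {E S : List F} → Unique E → Unique S → ∀ {d η} → 0 < d → η ≢ 0# →
    (∀ {y x} → y ∈ S → x ∈ E → (y - x) ^ d ≡ η) → length E ≤ d → d ℕ.+ length E ≤ p → length S ℕ.* length E ≤ d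
  length*length≤ {E} {[]} _ _ _ _ _ _ _ = z≤n
  length*length≤ {[]} {s ∷ S} _ _ _ _ _ _ _ = ℕₚ.≤-trans (ℕₚ.≤-reflexive (ℕₚ.*-zeroʳ (length S))) z≤n
  length*length≤ {e ∷ E} {s ∷ S} E! S! {d} 0<d η≢0 roots E≤d d+E≤p =
    Stepanov.length*length≤d E! S! 0<d η≢0 roots E≤d (ℕₚ.≤-trans (ℕₚ.≤-reflexive (sym (ℕₚ.+-suc d (length E)))) d+E≤p)

  -- Signs that arise when the two sets are exchanged

  x^n≢0 : ∀ {x} n → x ≢ 0# → x ^ n ≢ 0#
  x^n≢0 zero    x≢0 = 1≢0
  x^n≢0 (suc n) x≢0 = xy≢0 x≢0 (x^n≢0 n x≢0)

  -1≢0 : - 1# ≢ 0#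
  -1≢0 eq = 1≢0 (≡.trans (solve 1 (λ x → x := :- :- x) ≡.refl 1#) (≡.trans (cong -_ eq) -0#≈0#))

  [-1]^n≡±1 : ∀ n → (- 1#) ^ n ≡ 1# ⊎ (- 1#) ^ n ≡ - 1#
  [-1]^n≡±1 zero = inj₁ ≡.refl
  [-1]^n≡±1 (suc n) with [-1]^n≡±1 n
  ... | inj₁ eq = inj₂ (≡.trans (cong (- 1# *_) eq) (solve 0 (:- con (pos 1) :* con (pos 1) := :- con (pos 1)) ≡.refl))
  ... | inj₂ eq = inj₁ (≡.trans (cong (- 1# *_) eq) (solve 0 (:- con (pos 1) :* :- con (pos 1) := con (pos 1)) ≡.refl))

  swap-^ : ∀ x y d → (x - y) ^ d ≡ (- 1#) ^ d * (y - x) ^ d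
  swap-^ x y d = ≡.trans (cong (_^ d) (solve 2 (λ x y → x :- y := :- con (pos 1) :* (y :- x)) ≡.refl x y)) (^-distrib-* (- 1#) (y - x) d)

  inv-neg : ∀ x → inv (- x) ≡ - inv x
  inv-neg x with x ≟ 0#
  ... | yes ≡.refl = ≡.trans (inv-0 -0#≈0#) (sym -0#≈0#)
  ... | no x≢0 = *-cancelˡ -x≢0 (begin
      - x * inv (- x)          ≡⟨ *-inv -x≢0 ⟩
      1#                       ≡⟨ proj₂ (inverse x x≢0) ⟨
      x * i                    ≡⟨ solve 2 (λ x i → x :* i := :- x :* :- i) ≡.refl x i ⟩
      - x * - i                ∎)
    where
    open ≡-Reasoning
    i = proj₁ (inverse x x≢0)
    -x≢0 : - x ≢ 0#
    -x≢0 eq = x≢0 (≡.trans (solve 1 (λ x → x := :- :- x) ≡.refl x) (≡.trans (cong -_ eq) -0#≈0#))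

  inv-swap : ∀ x y → inv (x - y) ≡ - inv (y - x)
  inv-swap x y = ≡.trans (cong inv (solve 2 (λ x y → x :- y := :- (y :- x)) ≡.refl x y)) (inv-neg (y - x))

  -- Power sums

  powerSum : List F → ℕ → F
  powerSum X k = ∑ X (_^ k)

  powerSum-0 : ∀ X → powerSum X 0 ≡ ι (length X)
  powerSum-0 X = ≡.trans (∑-const X 1#) (*-comm _ _ ∙ *-identityˡ _)
    where
    _∙_ : ∀ {x y z : F} → x ≡ y → y ≡ z → x ≡ z
    _∙_ = ≡.trans

  ∑∑ : List F → List F → (F → F → F) → F
  ∑∑ S E f = ∑ S (λ y → ∑ E (f y))

  ∑∑-cong : ∀ S E {f g : F → F → F} → (∀ {y x} → y ∈ S → x ∈ E → f y x ≡ g y x) → ∑∑ S E f ≡ ∑∑ S E g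
  ∑∑-cong S E eq = ∑-cong S (λ y∈ → ∑-cong E (eq y∈))

  ∑∑-+ : ∀ S E (f g : F → F → F) → ∑∑ S E (λ y x → f y x + g y x) ≡ ∑∑ S E f + ∑∑ S E g
  ∑∑-+ S E f g = ≡.trans (∑-cong S (λ {y} _ → ∑-+ E (f y) (g y))) (∑-+ S _ _)

  ∑∑-- : ∀ S E (f g : F → F → F) → ∑∑ S E (λ y x → f y x - g y x) ≡ ∑∑ S E f - ∑∑ S E g
  ∑∑-- S E f g = ≡.trans (∑-cong S (λ {y} _ → ∑-- E (f y) (g y))) (∑-- S _ _)

  ∑∑-* : ∀ S E (f g : F → F) → ∑∑ S E (λ y x → f y * g x) ≡ ∑ S f * ∑ E g
  ∑∑-* S E f g = begin
    ∑ S (λ y → ∑ E (λ x → f y * g x))     ≡⟨ ∑-cong S (λ {y} _ → ≡.trans (∑-*ˡ E (f y) g) (*-comm _ _)) ⟩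
    ∑ S (λ y → ∑ E g * f y)               ≡⟨ ∑-*ˡ S (∑ E g) f ⟩
    ∑ E g * ∑ S f                         ≡⟨ *-comm _ _ ⟩
    ∑ S f * ∑ E g                         ∎
    where open ≡-Reasoning

  -- D k y x = (yᵏ⁺¹ - xᵏ⁺¹) / (y - x)
  D : ℕ → F → F → F
  D k y x = h (y ∷ x ∷ []) k

  D-divided-difference : ∀ k y x → (y - x) * D k y x ≡ y ^ suc k - x ^ suc k
  D-divided-difference k y x = ≡.trans (h-divided-difference y x [] k) (cong₂ _-_ (h-singleton y (suc k)) (h-singleton x (suc k)))

  D-suc : ∀ k y x → D (suc k) y x ≡ x ^ suc k + y * D k y x
  D-suc k y x = cong (_+ y * D k y x) (h-singleton x (suc k))

  D-diagonal : ∀ k y → D k y y ≡ ι (suc k) * y ^ k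
  D-diagonal zero y = sym (*-identityˡ _)
  D-diagonal (suc k) y = begin
    D (suc k) y y                           ≡⟨ D-suc k y y ⟩
    y ^ suc k + y * D k y y                 ≡⟨ cong (λ t → y ^ suc k + y * t) (D-diagonal k y) ⟩
    y * y ^ k + y * (ι (suc k) * y ^ k)     ≡⟨ solve 3 (λ y q i → y :* q :+ y :* (i :* q) := (con (pos 1) :+ i) :* (y :* q)) ≡.refl y (y ^ k) (ι (suc k)) ⟩
    (1# + ι (suc k)) * (y * y ^ k)          ≡⟨ cong (_* (y * y ^ k)) (ι-suc (suc k)) ⟨
    ι (2 ℕ.+ k) * y ^ suc k                 ∎
    where open ≡-Reasoning

  LowPowerSumsVanish : List F → ℕ → Set
  LowPowerSumsVanish X k = ∀ j → 0 < j → j < k → powerSum X j ≡ 0#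

  module _ (S E : List F) where
    private
      m n : F
      m = ι (length E)
      n = ι (length S)

    module _ {k : ℕ} (S-low : LowPowerSumsVanish S k) where

      private
        -- Such a double sum is a product of power sums. Hence in a homogeneous polynomial of degree
        -- `k` only the two pure powers survive summation over `S` and `E`.
        mixed : ∀ i j → 0 < i → i < k → ∑∑ S E (λ y x → y ^ i * x ^ j) ≡ 0#
        mixed i j 0<i i<k = ≡.trans (∑∑-* S E (_^ i) (_^ j)) (≡.trans (cong (_* powerSum E j) (S-low i 0<i i<k)) (zeroˡ _))

        i<k : ∀ i l → i ℕ.+ suc l ≡ k → i < k
        i<k i l eq = subst (i <_) eq (ℕₚ.m<m+n i (s≤s z≤n))

        pure : ∀ i → i ≡ k → ∑∑ S E (λ y x → y ^ i * x ^ 0) ≡ m * powerSum S k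
        pure i ≡.refl = ≡.trans (∑∑-* S E (_^ i) (_^ 0)) (≡.trans (cong (powerSum S i *_) (powerSum-0 E)) (*-comm _ _))

        ∑∑-y^i*D : ∀ l i → 0 < i → i ℕ.+ l ≡ k → ∑∑ S E (λ y x → y ^ i * D l y x) ≡ m * powerSum S k
        ∑∑-y^i*D zero i 0<i eq = pure i (≡.trans (sym (ℕₚ.+-identityʳ i)) eq)
        ∑∑-y^i*D (suc l) i 0<i eq = begin
          ∑∑ S E (λ y x → y ^ i * D (suc l) y x)
            ≡⟨ ∑∑-cong S E (λ {y} {x} _ _ → ≡.trans (cong (y ^ i *_) (D-suc l y x))
                 (solve 4 (λ a b y d → a :* (b :+ y :* d) := a :* b :+ (y :* a) :* d) ≡.refl (y ^ i) (x ^ suc l) y (D l y x))) ⟩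
          ∑∑ S E (λ y x → y ^ i * x ^ suc l + y ^ suc i * D l y x)
            ≡⟨ ∑∑-+ S E _ _ ⟩
          ∑∑ S E (λ y x → y ^ i * x ^ suc l) + ∑∑ S E (λ y x → y ^ suc i * D l y x)
            ≡⟨ cong₂ _+_ (mixed i (suc l) 0<i (i<k i l eq)) (∑∑-y^i*D l (suc i) (s≤s z≤n) (≡.trans (sym (ℕₚ.+-suc i l)) eq)) ⟩
          0# + m * powerSum S k
            ≡⟨ +-identityˡ _ ⟩
          m * powerSum S k ∎
          where open ≡-Reasoning

      -- `D k y x` is the sum of all y ^ i x ^ j with i + j = k, and every mixed term sums to zero.
      ∑∑-D : 0 < k → ∑∑ S E (D k) ≡ n * powerSum E k + m * powerSum S k
      ∑∑-D 0<k = go k 0<k ≡.refl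
        where
        go : ∀ k′ → 0 < k′ → k′ ≡ k → ∑∑ S E (D k′) ≡ n * powerSum E k′ + m * powerSum S k
        go (suc l) _ eq = begin
          ∑∑ S E (D (suc l))
            ≡⟨ ∑∑-cong S E (λ {y} {x} _ _ → ≡.trans (D-suc l y x)
                 (solve 3 (λ b y d → b :+ y :* d := con (pos 1) :* b :+ (y :* con (pos 1)) :* d) ≡.refl (x ^ suc l) y (D l y x))) ⟩
          ∑∑ S E (λ y x → y ^ 0 * x ^ suc l + y ^ 1 * D l y x)
            ≡⟨ ∑∑-+ S E _ _ ⟩
          ∑∑ S E (λ y x → y ^ 0 * x ^ suc l) + ∑∑ S E (λ y x → y ^ 1 * D l y x)
            ≡⟨ cong₂ _+_ (≡.trans (∑∑-* S E (_^ 0) (_^ suc l)) (cong (_* powerSum E (suc l)) (powerSum-0 S))) (∑∑-y^i*D l 1 (s≤s z≤n) eq) ⟩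
          n * powerSum E (suc l) + m * powerSum S k ∎
          where open ≡-Reasoning

      private
        -- Serves to expand `(y - x) ^ k` one factor at a time, the monomial in front collecting
        -- what has been expanded; this takes the place of the binomial theorem.
        U : ℕ → ℕ → ℕ → F
        U i j l = ∑∑ S E (λ y x → (y ^ i * x ^ j) * (y - x) ^ l)

        U-suc : ∀ i j l → U i j (suc l) ≡ U (suc i) j l - U i (suc j) l
        U-suc i j l = ≡.trans (∑∑-cong S E (λ {y} {x} _ _ →
            solve 5 (λ a b y x q → (a :* b) :* ((y :- x) :* q) := ((y :* a) :* b) :* q :- (a :* (x :* b)) :* q) ≡.refl (y ^ i) (x ^ j) y x ((y - x) ^ l)))
          (∑∑-- S E _ _)

        U-zero : ∀ i j → U i j 0 ≡ ∑∑ S E (λ y x → y ^ i * x ^ j)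
        U-zero i j = ∑∑-cong S E (λ _ _ → ≡.trans (*-comm _ _) (*-identityˡ _))

        U-mixed : ∀ l i j → 0 < i → 0 < j → (i ℕ.+ j) ℕ.+ l ≡ k → U i j l ≡ 0#
        U-mixed zero i (suc j) 0<i _ eq = ≡.trans (U-zero i (suc j)) (mixed i (suc j) 0<i (i<k i j (≡.trans (sym (ℕₚ.+-identityʳ _)) eq)))
        U-mixed (suc l) i j 0<i 0<j eq = begin
          U i j (suc l)                       ≡⟨ U-suc i j l ⟩
          U (suc i) j l - U i (suc j) l       ≡⟨ cong₂ _-_ (U-mixed l (suc i) j (s≤s z≤n) 0<j eq′)
                                                   (U-mixed l i (suc j) 0<i (s≤s z≤n) (≡.trans (cong (ℕ._+ l) (ℕₚ.+-suc i j)) eq′)) ⟩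
          0# - 0#                             ≡⟨ -‿inverseʳ 0# ⟩
          0#                                  ∎
          where
          open ≡-Reasoning
          eq′ : (suc i ℕ.+ j) ℕ.+ l ≡ k
          eq′ = ≡.trans (sym (ℕₚ.+-suc (i ℕ.+ j) l)) eq

        U-left : ∀ l i → 0 < i → i ℕ.+ l ≡ k → U i 0 l ≡ m * powerSum S k
        U-left zero i 0<i eq = ≡.trans (U-zero i 0) (pure i (≡.trans (sym (ℕₚ.+-identityʳ i)) eq))
        U-left (suc l) i 0<i eq = begin
          U i 0 (suc l)                       ≡⟨ U-suc i 0 l ⟩
          U (suc i) 0 l - U i 1 l             ≡⟨ cong₂ _-_ (U-left l (suc i) (s≤s z≤n) eq′)
                                                   (U-mixed l i 1 0<i (s≤s z≤n) (≡.trans (cong (ℕ._+ l) (ℕₚ.+-comm i 1)) eq′)) ⟩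
          m * powerSum S k - 0#               ≡⟨ solve 1 (λ x → x :- con (pos 0) := x) ≡.refl _ ⟩
          m * powerSum S k                    ∎
          where
          open ≡-Reasoning
          eq′ : suc i ℕ.+ l ≡ k
          eq′ = ≡.trans (sym (ℕₚ.+-suc i l)) eq

        U-right : ∀ l j → 0 < j → j ℕ.+ l ≡ k → U 0 j l ≡ (- 1#) ^ l * (n * powerSum E k)
        U-right zero j 0<j eq = begin
          U 0 j 0                             ≡⟨ U-zero 0 j ⟩
          ∑∑ S E (λ y x → y ^ 0 * x ^ j)      ≡⟨ ∑∑-* S E (_^ 0) (_^ j) ⟩
          powerSum S 0 * powerSum E j         ≡⟨ cong₂ (λ t i → t * powerSum E i) (powerSum-0 S) (≡.trans (sym (ℕₚ.+-identityʳ j)) eq) ⟩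
          n * powerSum E k                    ≡⟨ *-identityˡ _ ⟨
          1# * (n * powerSum E k)             ∎
          where open ≡-Reasoning
        U-right (suc l) j 0<j eq = begin
          U 0 j (suc l)                       ≡⟨ U-suc 0 j l ⟩
          U 1 j l - U 0 (suc j) l             ≡⟨ cong₂ _-_ (U-mixed l 1 j (s≤s z≤n) 0<j eq′) (U-right l (suc j) (s≤s z≤n) eq′) ⟩
          0# - (- 1#) ^ l * (n * powerSum E k)    ≡⟨ solve 2 (λ s x → con (pos 0) :- s :* x := (:- con (pos 1) :* s) :* x) ≡.refl ((- 1#) ^ l) _ ⟩
          (- 1#) ^ suc l * (n * powerSum E k) ∎
          where
          open ≡-Reasoning
          eq′ : suc j ℕ.+ l ≡ k
          eq′ = ≡.trans (sym (ℕₚ.+-suc j l)) eq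

      -- Only the two end terms of the binomial expansion survive. The sign is written with
      -- `l = k - 1` after a minus sign.
      ∑∑-difference^k : ∀ l → suc l ≡ k →
        ∑∑ S E (λ y x → (y - x) ^ suc l) ≡ m * powerSum S k - (- 1#) ^ l * (n * powerSum E k)
      ∑∑-difference^k l eq = begin
        ∑∑ S E (λ y x → (y - x) ^ suc l)      ≡⟨ ∑∑-cong S E (λ {y} {x} _ _ → solve 1 (λ q → q := (con (pos 1) :* con (pos 1)) :* q) ≡.refl _) ⟩
        U 0 0 (suc l)                         ≡⟨ U-suc 0 0 l ⟩
        U 1 0 l - U 0 1 l                     ≡⟨ cong₂ _-_ (U-left l 1 (s≤s z≤n) eq) (U-right l 1 (s≤s z≤n) eq) ⟩
        m * powerSum S k - (- 1#) ^ l * (n * powerSum E k) ∎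
        where open ≡-Reasoning

  private
    -- `1# - z * inv z` is the indicator of `z = 0`, so only the term `x = y` remains.
    diagonal-kills : ∀ {X} → Unique X → ∀ {y} → y ∈ X → (g : F → F) → ∑ X (λ x → (1# - (y - x) * inv (y - x)) * g x) ≡ g y
    diagonal-kills {X} X! {y} y∈X g with X′ , X↭ ← ∈⇒↭∷ y∈X = begin
      ∑ X (λ x → δ x * g x)                 ≡⟨ ∑-↭ X↭ (λ x → δ x * g x) ⟩
      δ y * g y + ∑ X′ (λ x → δ x * g x)    ≡⟨ cong₂ (λ a b → a * g y + b) δ-same (∑-zero X′ (λ {x} x∈ → ≡.trans (cong (_* g x) (δ-other x∈)) (zeroˡ _))) ⟩
      1# * g y + 0#                         ≡⟨ solve 1 (λ x → con (pos 1) :* x :+ con (pos 0) := x) ≡.refl (g y) ⟩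
      g y                                   ∎
      where
      open ≡-Reasoning
      δ : F → F
      δ x = 1# - (y - x) * inv (y - x)
      δ-same : δ y ≡ 1#
      δ-same = solve 2 (λ y i → con (pos 1) :- (y :- y) :* i := con (pos 1)) ≡.refl y (inv (y - y))
      δ-other : ∀ {x} → x ∈ X′ → δ x ≡ 0#
      δ-other x∈ = x≡y⇒x-y≡0 (sym (*-inv (x≢y⇒x-y≢0 (All.lookup (AllPairs.head (Unique-resp-↭ X↭ X!)) x∈))))

  -- The sum over x = y is absent on the left because inv 0 = 0.
  ∑∑-self : ∀ {X} → Unique X → ∀ {k} → 0 < k → LowPowerSumsVanish X k →
    (1# + 1#) * ∑ X (λ y → y ^ suc k * ∑ X (λ x → inv (y - x)))
      ≡ ((1# + 1#) * ι (length X) - ι (suc k)) * powerSum X k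
  ∑∑-self {X} X! {k} 0<k low = begin
    (1# + 1#) * ∑ X (λ y → y ^ suc k * ∑ X (λ x → inv (y - x)))
      ≡⟨ cong ((1# + 1#) *_) (∑-cong X (λ {y} _ → sym (∑-*ˡ X (y ^ suc k) _))) ⟩
    (1# + 1#) * T
      ≡⟨ solve 1 (λ t → (con (pos 1) :+ con (pos 1)) :* t := t :+ t) ≡.refl T ⟩
    -- Adding the same sum with `x` and `y` exchanged turns the off-diagonal terms into difference
    -- quotients `D k y x`. `D` is also defined for `x = y`, so its diagonal has to be subtracted;
    -- this produces the term with `suc k`.
    T + T
      ≡⟨ cong (T +_) (∑-swap X X (λ y x → y ^ suc k * inv (y - x))) ⟩
    T + ∑∑ X X (λ y x → x ^ suc k * inv (x - y))
      ≡⟨ ∑∑-+ X X _ _ ⟨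
    ∑∑ X X (λ y x → y ^ suc k * inv (y - x) + x ^ suc k * inv (x - y))
      ≡⟨ ∑∑-cong X X (λ {y} {x} _ _ → ≡.trans (cong (λ t → y ^ suc k * inv (y - x) + x ^ suc k * t) (inv-swap x y)) (pair y x)) ⟩
    ∑∑ X X (λ y x → D k y x - (1# - (y - x) * inv (y - x)) * D k y x)
      ≡⟨ ∑∑-- X X _ _ ⟩
    ∑∑ X X (D k) - ∑∑ X X (λ y x → (1# - (y - x) * inv (y - x)) * D k y x)
      ≡⟨ cong₂ _-_ (∑∑-D X X low 0<k)
           (≡.trans (∑-cong X (λ {y} y∈ → ≡.trans (diagonal-kills X! y∈ (D k y)) (D-diagonal k y))) (∑-*ˡ X (ι (suc k)) (_^ k))) ⟩
    (n * powerSum X k + n * powerSum X k) - ι (suc k) * powerSum X k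
      ≡⟨ solve 3 (λ n q i → (n :* q :+ n :* q) :- i :* q := ((con (pos 1) :+ con (pos 1)) :* n :- i) :* q) ≡.refl n (powerSum X k) (ι (suc k)) ⟩
    ((1# + 1#) * n - ι (suc k)) * powerSum X k ∎
    where
    open ≡-Reasoning
    n = ι (length X)
    T = ∑∑ X X (λ y x → y ^ suc k * inv (y - x))
    pair : ∀ y x → y ^ suc k * inv (y - x) + x ^ suc k * - inv (y - x) ≡ D k y x - (1# - (y - x) * inv (y - x)) * D k y x
    pair y x = begin
      y ^ suc k * i + x ^ suc k * - i              ≡⟨ solve 3 (λ a b i → a :* i :+ b :* :- i := (a :- b) :* i) ≡.refl (y ^ suc k) (x ^ suc k) i ⟩
      (y ^ suc k - x ^ suc k) * i                  ≡⟨ cong (_* i) (D-divided-difference k y x) ⟨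
      ((y - x) * D k y x) * i                      ≡⟨ solve 3 (λ z d i → (z :* d) :* i := d :- (con (pos 1) :- z :* i) :* d) ≡.refl (y - x) (D k y x) i ⟩
      D k y x - (1# - (y - x) * i) * D k y x       ∎
      where i = inv (y - x)

  -- Power sums of two sets that satisfy the electrostatic equations

  module Decomposition {E S : List F} (E! : Unique E) (S! : Unique S) {d : ℕ} {η : F} (η≢0 : η ≢ 0#)
    (roots : ∀ {y x} → y ∈ S → x ∈ E → (y - x) ^ d ≡ η)
    (2≤E : 2 ≤ length E) (2≤S : 2 ≤ length S) (S*E≡d : length S ℕ.* length E ≡ d) (d+d≤p : d ℕ.+ d ≤ p)
    (differences-vanish : ∀ k → 0 < k → k < d → ∑∑ S E (λ y x → (y - x) ^ k) ≡ 0#) where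

    private
      m n : F
      m = ι (length E)
      n = ι (length S)

      0<E : 0 < length E
      0<E = ℕₚ.<⇒≤ 2≤E

      0<S : 0 < length S
      0<S = ℕₚ.<⇒≤ 2≤S

      2E≤d : length E ℕ.+ length E ≤ d
      2E≤d = ℕₚ.≤-trans (ℕₚ.≤-reflexive (cong (length E ℕ.+_) (sym (ℕₚ.+-identityʳ _))))
        (ℕₚ.≤-trans (ℕₚ.*-monoˡ-≤ (length E) 2≤S) (ℕₚ.≤-reflexive S*E≡d))

      E*S≡d : length E ℕ.* length S ≡ d
      E*S≡d = ≡.trans (ℕₚ.*-comm (length E) _) S*E≡d

      2S≤d : length S ℕ.+ length S ≤ d
      2S≤d = ℕₚ.≤-trans (ℕₚ.≤-reflexive (cong (length S ℕ.+_) (sym (ℕₚ.+-identityʳ _))))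
        (ℕₚ.≤-trans (ℕₚ.*-monoˡ-≤ (length S) 2≤E) (ℕₚ.≤-reflexive E*S≡d))

      E<d : length E < d
      E<d = ℕₚ.<-≤-trans (ℕₚ.m<m+n (length E) 0<E) 2E≤d

      S<d : length S < d
      S<d = ℕₚ.<-≤-trans (ℕₚ.m<m+n (length S) 0<S) 2S≤d

      0<d : 0 < d
      0<d = ℕₚ.<-trans 0<E E<d

      d+≤p : ∀ {k} → k < d → d ℕ.+ k ≤ p
      d+≤p k<d = ℕₚ.≤-trans (ℕₚ.+-monoʳ-≤ d (ℕₚ.<⇒≤ k<d)) d+d≤p

      4≤d : 4 ≤ d
      4≤d = ℕₚ.≤-trans (ℕₚ.*-mono-≤ 2≤S 2≤E) (ℕₚ.≤-reflexive S*E≡d)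

      d+k<p : ∀ {k} → k < 4 → d ℕ.+ k < p
      d+k<p {k} k<4 = ℕₚ.<-≤-trans (ℕₚ.+-monoʳ-< d (ℕₚ.<-≤-trans k<4 4≤d)) d+d≤p

      E+S≤d : length E ℕ.+ length S ≤ d
      E+S≤d with ℕₚ.≤-total (length E) (length S)
      ... | inj₁ E≤S = ℕₚ.≤-trans (ℕₚ.+-monoˡ-≤ (length S) E≤S) 2S≤d
      ... | inj₂ S≤E = ℕₚ.≤-trans (ℕₚ.+-monoʳ-≤ (length E) S≤E) 2E≤d

      ι≢0-< : ∀ {k} → 0 < k → k < d → ι k ≢ 0#
      ι≢0-< 0<k k<d = ι≢0 _ 0<k (ℕₚ.<-≤-trans k<d (ℕₚ.≤-trans (ℕₚ.m≤m+n d d) d+d≤p))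

      m≢0 : m ≢ 0#
      m≢0 = ι≢0-< 0<E E<d

      n≢0 : n ≢ 0#
      n≢0 = ι≢0-< 0<S S<d

      y≢x : ∀ {y x} → y ∈ S → x ∈ E → y - x ≢ 0#
      y≢x y∈S x∈E = ^≢0 0<d η≢0 (roots y∈S x∈E)

      ιd-1 : ι d - 1# ≡ m * n - 1#
      ιd-1 = cong (_- 1#) (≡.trans (cong ι (sym E*S≡d)) (ι-* (length E) (length S)))

      swapped-roots : ∀ {x y} → x ∈ E → y ∈ S → (x - y) ^ d ≡ (- 1#) ^ d * η
      swapped-roots {x} {y} x∈E y∈S = ≡.trans (swap-^ x y d) (cong ((- 1#) ^ d *_) (roots y∈S x∈E))

      -- The right side becomes a power sum by `∑∑-self`, which evaluates twice the
      -- self-interaction; hence the factor two.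
      weighted : ∀ X Y → Unique X → ∀ {k} → 0 < k → LowPowerSumsVanish X k → ∀ c c′ →
        (∀ {y} → y ∈ X → c * ∑ Y (λ x → inv (y - x)) ≡ c′ * ∑ X (λ x → inv (y - x))) →
        (1# + 1#) * (c * ∑∑ X Y (λ y x → y ^ suc k * inv (y - x)))
          ≡ c′ * (((1# + 1#) * ι (length X) - ι (suc k)) * powerSum X k)
      weighted X Y X! {k} 0<k low c c′ relation = begin
        (1# + 1#) * (c * ∑∑ X Y (λ y x → y ^ suc k * inv (y - x)))
          ≡⟨ cong (λ t → (1# + 1#) * (c * t)) (∑-cong X (λ {y} _ → ∑-*ˡ Y (y ^ suc k) _)) ⟩
        (1# + 1#) * (c * ∑ X (λ y → y ^ suc k * ∑ Y (λ x → inv (y - x))))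
          ≡⟨ cong ((1# + 1#) *_) (sym (∑-*ˡ X c _)) ⟩
        (1# + 1#) * ∑ X (λ y → c * (y ^ suc k * ∑ Y (λ x → inv (y - x))))
          ≡⟨ cong ((1# + 1#) *_) (∑-cong X (λ {y} y∈ → ≡.trans (exchange c (y ^ suc k) _) (≡.trans (cong (y ^ suc k *_) (relation y∈)) (exchange (y ^ suc k) c′ _)))) ⟩
        (1# + 1#) * ∑ X (λ y → c′ * (y ^ suc k * ∑ X (λ x → inv (y - x))))
          ≡⟨ ≡.trans (cong ((1# + 1#) *_) (∑-*ˡ X c′ _)) (exchange (1# + 1#) c′ _) ⟩
        c′ * ((1# + 1#) * ∑ X (λ y → y ^ suc k * ∑ X (λ x → inv (y - x))))
          ≡⟨ cong (c′ *_) (∑∑-self X! 0<k low) ⟩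
        c′ * (((1# + 1#) * ι (length X) - ι (suc k)) * powerSum X k) ∎
        where
        open ≡-Reasoning
        exchange : ∀ a b c → a * (b * c) ≡ b * (a * c)
        exchange = solve 3 (λ a b c → a :* (b :* c) := b :* (a :* c)) ≡.refl

    module _ {k : ℕ} (0<k : 0 < k) (E-low : LowPowerSumsVanish E k) (S-low : LowPowerSumsVanish S k) where

      private
        σ ε κ : F
        σ = powerSum S k
        ε = powerSum E k
        κ = ι (suc k)

        two : F
        two = 1# + 1#

        -- As 1 / (x - y) = - 1 / (y - x), the two cross sums combine termwise into `D k`. Their
        -- individual values remain unknown.
        difference-quotients : ∑∑ S E (λ y x → y ^ suc k * inv (y - x)) + ∑∑ E S (λ x y → x ^ suc k * inv (x - y)) ≡ n * ε + m * σ
        difference-quotients = begin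
          ∑∑ S E (λ y x → y ^ suc k * inv (y - x)) + ∑∑ E S (λ x y → x ^ suc k * inv (x - y))
            ≡⟨ cong (∑∑ S E (λ y x → y ^ suc k * inv (y - x)) +_) (∑-swap E S _) ⟩
          ∑∑ S E (λ y x → y ^ suc k * inv (y - x)) + ∑∑ S E (λ y x → x ^ suc k * inv (x - y))
            ≡⟨ ∑∑-+ S E _ _ ⟨
          ∑∑ S E (λ y x → y ^ suc k * inv (y - x) + x ^ suc k * inv (x - y))
            ≡⟨ ∑∑-cong S E (λ y∈S x∈E → quotient (y≢x y∈S x∈E)) ⟩
          ∑∑ S E (D k)
            ≡⟨ ∑∑-D S E S-low 0<k ⟩
          n * ε + m * σ ∎
          where
          open ≡-Reasoning
          quotient : ∀ {y x} → y - x ≢ 0# → y ^ suc k * inv (y - x) + x ^ suc k * inv (x - y) ≡ D k y x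
          quotient {y} {x} y-x≢0 = begin
            y ^ suc k * i + x ^ suc k * inv (x - y)   ≡⟨ cong (λ t → y ^ suc k * i + x ^ suc k * t) (inv-swap x y) ⟩
            y ^ suc k * i + x ^ suc k * - i           ≡⟨ solve 3 (λ a b i → a :* i :+ b :* :- i := i :* (a :- b)) ≡.refl (y ^ suc k) (x ^ suc k) i ⟩
            i * (y ^ suc k - x ^ suc k)               ≡⟨ cong (i *_) (D-divided-difference k y x) ⟨
            i * ((y - x) * D k y x)                   ≡⟨ solve 3 (λ i z d → i :* (z :* d) := (z :* i) :* d) ≡.refl i (y - x) (D k y x) ⟩
            ((y - x) * i) * D k y x                   ≡⟨ cong (_* D k y x) (*-inv y-x≢0) ⟩
            1# * D k y x                              ≡⟨ *-identityˡ _ ⟩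
            D k y x                                   ∎
            where i = inv (y - x)

      -- The weighted equations at `S` and at `E` carry the same factor `ι d - 1#`, so their sum
      -- involves the cross sums only through the total found in `difference-quotients`.
      moment-relation : (1# + m) * (two * n - κ) * (m * σ) + (1# + n) * (two * m - κ) * (n * ε)
        ≡ two * (m * n - 1#) * (n * ε + m * σ)
      moment-relation = begin
        (1# + m) * (two * n - κ) * (m * σ) + (1# + n) * (two * m - κ) * (n * ε)
          ≡⟨ solve 6 (λ m n a b s e → (con (pos 1) :+ m) :* a :* (m :* s) :+ (con (pos 1) :+ n) :* b :* (n :* e)
               := (m :* (con (pos 1) :+ m)) :* (a :* s) :+ (n :* (con (pos 1) :+ n)) :* (b :* e)) ≡.refl m n (two * n - κ) (two * m - κ) σ ε ⟩
        (m * (1# + m)) * ((two * n - κ) * σ) + (n * (1# + n)) * ((two * m - κ) * ε)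
          ≡⟨ cong₂ (λ a b → (m * a) * ((two * n - κ) * σ) + (n * b) * ((two * m - κ) * ε)) (ι-suc (length E)) (ι-suc (length S)) ⟨
        (m * ι (suc (length E))) * ((two * n - κ) * σ) + (n * ι (suc (length S))) * ((two * m - κ) * ε)
          ≡⟨ cong₂ _+_
               (weighted S E S! 0<k S-low (ι d - 1#) _ (λ y∈S → stieltjes E! S! 0<d η≢0 roots 0<E E<d (d+≤p E<d) S*E≡d y∈S))
               (weighted E S E! 0<k E-low (ι d - 1#) _ (λ x∈E → stieltjes S! E! 0<d (xy≢0 (x^n≢0 d -1≢0) η≢0) swapped-roots 0<S S<d (d+≤p S<d) E*S≡d x∈E)) ⟨
        two * ((ι d - 1#) * P) + two * ((ι d - 1#) * Q)
          ≡⟨ solve 4 (λ t c p q → t :* (c :* p) :+ t :* (c :* q) := t :* c :* (p :+ q)) ≡.refl two (ι d - 1#) P Q ⟩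
        two * (ι d - 1#) * (P + Q)
          ≡⟨ cong₂ (λ a b → two * a * b) ιd-1 difference-quotients ⟩
        two * (m * n - 1#) * (n * ε + m * σ) ∎
        where
        open ≡-Reasoning
        P = ∑∑ S E (λ y x → y ^ suc k * inv (y - x))
        Q = ∑∑ E S (λ x y → x ^ suc k * inv (x - y))

      -- The second linear relation between `m * σ` and `n * ε`: the k-th powers of the differences
      -- sum to zero.
      power-sums-≡ : k < d → ∃ λ l → m * σ ≡ (- 1#) ^ l * (n * ε)
      power-sums-≡ k<d = go k 0<k ≡.refl
        where
        go : ∀ k′ → 0 < k′ → k′ ≡ k → ∃ λ l → m * σ ≡ (- 1#) ^ l * (n * ε)
        go (suc l) 0<k′ eq = l , x-y≡0⇒x≡y (≡.trans (sym (∑∑-difference^k S E S-low l eq))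
          (differences-vanish (suc l) 0<k′ (subst (_< d) (sym eq) k<d)))

      both-vanish : ∀ {s} → m * σ ≡ s * (n * ε) → n * ε ≡ 0# → σ ≡ 0# × ε ≡ 0#
      both-vanish eq nε≡0 = xy≡0⇒y≡0 m≢0 (≡.trans eq (≡.trans (cong (_ *_) nε≡0) (zeroʳ _))) , xy≡0⇒y≡0 n≢0 nε≡0

      -- With `m * σ = ± (n * ε)`, `moment-relation` collapses to a multiple of `n * ε`: (m + n + 2)
      -- (k - 1) for the plus sign, (m - n) (k + 3) for the minus sign. `1 < k` and `m ≠ n` exclude
      -- integer zeros, and m + n + 2 and k + 3 are at most d + 2 < p.
      power-sums-vanish : length E ≢ length S → 1 < k → k ≤ length E → σ ≡ 0# × ε ≡ 0#
      power-sums-vanish E≢S 1<k k≤E with power-sums-≡ (ℕₚ.≤-<-trans k≤E E<d)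
      ... | l , eq = both-vanish eq (case-sign ([-1]^n≡±1 l))
        where
        open ≡-Reasoning
        t u : F
        t = m * σ
        u = n * ε

        relation-0 : (1# + m) * (two * n - κ) * t + (1# + n) * (two * m - κ) * u - two * (m * n - 1#) * (u + t) ≡ 0#
        relation-0 = x≡y⇒x-y≡0 moment-relation

        sum≢0 : two + (m + n) ≢ 0#
        sum≢0 eq = ι≢0 (2 ℕ.+ (length E ℕ.+ length S)) (s≤s z≤n)
          (ℕₚ.≤-<-trans (ℕₚ.≤-trans (ℕₚ.+-monoʳ-≤ 2 E+S≤d) (ℕₚ.≤-reflexive (ℕₚ.+-comm 2 d))) (d+k<p (s≤s (s≤s (s≤s z≤n)))))
          (≡.trans (≡.trans (ι-+ 2 (length E ℕ.+ length S)) (cong (two +_) (ι-+ (length E) (length S)))) eq)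

        κ-2≢0 : κ - two ≢ 0#
        κ-2≢0 eq = ι≢0-< (ℕₚ.m<n⇒0<n∸m 1<k) (ℕₚ.≤-<-trans (ℕₚ.≤-trans (ℕₚ.m∸n≤m k 1) k≤E) E<d) (≡.trans (ι-∸ (s≤s 0<k)) eq)

        κ+2≢0 : two + κ ≢ 0#
        κ+2≢0 eq = ι≢0 (2 ℕ.+ suc k) (s≤s z≤n)
          (ℕₚ.≤-<-trans (ℕₚ.≤-trans (ℕₚ.+-monoʳ-≤ 2 (ℕₚ.≤-<-trans k≤E E<d)) (ℕₚ.≤-reflexive (ℕₚ.+-comm 2 d))) (d+k<p (s≤s (s≤s (s≤s z≤n)))))
          (≡.trans (ι-+ 2 (suc k)) eq)

        m-n≢0 : m - n ≢ 0#
        m-n≢0 eq with ℕₚ.<-cmp (length E) (length S)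
        ... | tri≈ _ E≡S _ = E≢S E≡S
        ... | tri> _ _ S<E = ι≢0-< (ℕₚ.m<n⇒0<n∸m S<E) (ℕₚ.≤-<-trans (ℕₚ.m∸n≤m (length E) (length S)) E<d) (≡.trans (ι-∸ (ℕₚ.<⇒≤ S<E)) eq)
        ... | tri< E<S _ _ = ι≢0-< (ℕₚ.m<n⇒0<n∸m E<S) (ℕₚ.≤-<-trans (ℕₚ.m∸n≤m (length S) (length E)) S<d)
          (≡.trans (ι-∸ (ℕₚ.<⇒≤ E<S)) (x≡y⇒x-y≡0 (sym (x-y≡0⇒x≡y eq))))

        case-sign : (- 1#) ^ l ≡ 1# ⊎ (- 1#) ^ l ≡ - 1# → u ≡ 0#
        case-sign (inj₁ sign≡1) = xy≡0⇒y≡0 (xy≢0 sum≢0 κ-2≢0) (begin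
          (two + (m + n)) * (κ - two) * u
            ≡⟨ solve 4 (λ m n k u → ((con (pos 1) :+ con (pos 1)) :+ (m :+ n)) :* (k :- (con (pos 1) :+ con (pos 1))) :* u
                 := :- ((con (pos 1) :+ m) :* ((con (pos 1) :+ con (pos 1)) :* n :- k) :* u :+ (con (pos 1) :+ n) :* ((con (pos 1) :+ con (pos 1)) :* m :- k) :* u
                        :- (con (pos 1) :+ con (pos 1)) :* (m :* n :- con (pos 1)) :* (u :+ u))) ≡.refl m n κ u ⟩
          - ((1# + m) * (two * n - κ) * u + (1# + n) * (two * m - κ) * u - two * (m * n - 1#) * (u + u))
            ≡⟨ cong (λ t → - ((1# + m) * (two * n - κ) * t + (1# + n) * (two * m - κ) * u - two * (m * n - 1#) * (u + t)))
                 (≡.trans eq (≡.trans (cong (_* u) sign≡1) (*-identityˡ u))) ⟨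
          - ((1# + m) * (two * n - κ) * t + (1# + n) * (two * m - κ) * u - two * (m * n - 1#) * (u + t))
            ≡⟨ ≡.trans (cong -_ relation-0) -0#≈0# ⟩
          0# ∎)
        case-sign (inj₂ sign≡-1) = xy≡0⇒y≡0 (xy≢0 m-n≢0 κ+2≢0) (begin
          (m - n) * (two + κ) * u
            ≡⟨ solve 4 (λ m n k u → (m :- n) :* ((con (pos 1) :+ con (pos 1)) :+ k) :* u
                 := (con (pos 1) :+ m) :* ((con (pos 1) :+ con (pos 1)) :* n :- k) :* (:- con (pos 1) :* u) :+ (con (pos 1) :+ n) :* ((con (pos 1) :+ con (pos 1)) :* m :- k) :* u
                        :- (con (pos 1) :+ con (pos 1)) :* (m :* n :- con (pos 1)) :* (u :+ :- con (pos 1) :* u)) ≡.refl m n κ u ⟩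
          (1# + m) * (two * n - κ) * (- 1# * u) + (1# + n) * (two * m - κ) * u - two * (m * n - 1#) * (u + - 1# * u)
            ≡⟨ cong (λ t → (1# + m) * (two * n - κ) * t + (1# + n) * (two * m - κ) * u - two * (m * n - 1#) * (u + t))
                 (≡.trans eq (cong (_* u) sign≡-1)) ⟨
          (1# + m) * (two * n - κ) * t + (1# + n) * (two * m - κ) * u - two * (m * n - 1#) * (u + t)
            ≡⟨ relation-0 ⟩
          0# ∎)

    all-power-sums-vanish : length E ≢ length S → powerSum E 1 ≡ 0# →
      ∀ K → K ≤ suc (length E) → LowPowerSumsVanish S K × LowPowerSumsVanish E K
    all-power-sums-vanish E≢S centred zero _ = (λ _ _ ()) , (λ _ _ ())
    all-power-sums-vanish E≢S centred (suc K) (s≤s K≤E) with all-power-sums-vanish E≢S centred K (ℕₚ.m≤n⇒m≤1+n K≤E)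
    ... | S-low , E-low = (λ j 0<j j≤K → proj₁ (extend j 0<j j≤K)) , (λ j 0<j j≤K → proj₂ (extend j 0<j j≤K))
      where
      extend : ∀ j → 0 < j → j < suc K → powerSum S j ≡ 0# × powerSum E j ≡ 0#
      extend j 0<j (s≤s j≤K) with ℕₚ.m≤n⇒m<n∨m≡n j≤K
      ... | inj₁ j<K = S-low j 0<j j<K , E-low j 0<j j<K
      -- For exponent 1 the factor k - 1 is zero, and centring replaces it. Centring `E` is enough,
      -- since `power-sums-≡` carries it over to `S`.
      extend 1 0<j (s≤s j≤K) | inj₂ ≡.refl with power-sums-≡ 0<j E-low S-low (ℕₚ.≤-<-trans K≤E E<d)
      ... | l , eq = both-vanish 0<j E-low S-low eq (≡.trans (cong (n *_) centred) (zeroʳ n))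
      extend (suc (suc j)) 0<j (s≤s j≤K) | inj₂ ≡.refl = power-sums-vanish 0<j E-low S-low E≢S (s≤s (s≤s z≤n)) K≤E

  -- Power sums cannot all vanish

  ∏-differences : List F → F → F
  ∏-differences []      x = 1#
  ∏-differences (r ∷ R) x = (x - r) * ∏-differences R x

  ∏-differences-∈ : ∀ {R x} → x ∈ R → ∏-differences R x ≡ 0#
  ∏-differences-∈ {r ∷ R} {x} (here ≡.refl) = ≡.trans (cong (_* ∏-differences R x) (-‿inverseʳ x)) (zeroˡ _)
  ∏-differences-∈ {r ∷ R} {x} (there x∈R)   = ≡.trans (cong ((x - r) *_) (∏-differences-∈ x∈R)) (zeroʳ _)

  ∏-differences-≢0 : ∀ {R x} → All (x ≢_) R → ∏-differences R x ≢ 0#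
  ∏-differences-≢0 []          = 1≢0
  ∏-differences-≢0 (x≢r ∷ x∉R) = xy≢0 (x≢y⇒x-y≢0 x≢r) (∏-differences-≢0 x∉R)

  -- Take a nonzero `e` in `E` and let `R` be the rest of `E`. The polynomial x ∏ (x - r) has degree
  -- |E| and no constant term, so its sum over `E` is a combination of vanishing power sums; but
  -- `x = e` is the only term of that sum that is not zero.
  ¬power-sums-vanish : ∀ {E} → Unique E → 2 ≤ length E → ¬ LowPowerSumsVanish E (suc (length E))
  ¬power-sums-vanish {E} E! 2≤E low with nonzero E E! 2≤E
    where
    nonzero : ∀ E → Unique E → 2 ≤ length E → ∃ λ e → e ∈ E × e ≢ 0#
    nonzero (x ∷ y ∷ _) ((x≢y ∷ _) ∷ _) _ with x ≟ 0#
    ... | no x≢0     = x , here ≡.refl , x≢0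
    ... | yes ≡.refl = y , there (here ≡.refl) , λ y≡0 → x≢y (sym y≡0)
    nonzero (x ∷ []) _ (s≤s ())
  ... | e , e∈E , e≢0 with R , E↭ ← ∈⇒↭∷ e∈E =
    xy≢0 (x^n≢0 1 e≢0) (∏-differences-≢0 (AllPairs.head (Unique-resp-↭ E↭ E!))) (begin
      e ^ 1 * ∏-differences R e                      ≡⟨ +-identityʳ _ ⟨
      e ^ 1 * ∏-differences R e + 0#                 ≡⟨ cong (e ^ 1 * ∏-differences R e +_) (∑-zero R (λ {x} x∈R → ≡.trans (cong (x ^ 1 *_) (∏-differences-∈ x∈R)) (zeroʳ _))) ⟨
      ∑ (e ∷ R) (λ x → x ^ 1 * ∏-differences R x)    ≡⟨ ∑-↭ E↭ (λ x → x ^ 1 * ∏-differences R x) ⟨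
      ∑ E (λ x → x ^ 1 * ∏-differences R x)          ≡⟨ vanish R 0 (ℕₚ.≤-reflexive (sym (↭-length E↭))) ⟩
      0#                                             ∎)
    where
    open ≡-Reasoning
    -- Multiplying out one root at a time keeps all exponents between 1 and |E|, as the bound on
    -- `suc i` and `length R` records.
    vanish : ∀ R i → suc i ℕ.+ length R ≤ length E → ∑ E (λ x → x ^ suc i * ∏-differences R x) ≡ 0#
    vanish [] i len = ≡.trans (∑-cong E (λ _ → ≡.trans (*-comm _ _) (*-identityˡ _)))
      (low (suc i) (s≤s z≤n) (s≤s (ℕₚ.≤-trans (ℕₚ.≤-reflexive (sym (ℕₚ.+-identityʳ _))) len)))
    vanish (r ∷ R) i len = begin
      ∑ E (λ x → x ^ suc i * ((x - r) * ∏-differences R x))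
        ≡⟨ ∑-cong E (λ {x} _ → solve 4 (λ q x r t → q :* ((x :- r) :* t) := (x :* q) :* t :- r :* (q :* t)) ≡.refl (x ^ suc i) x r (∏-differences R x)) ⟩
      ∑ E (λ x → x ^ suc (suc i) * ∏-differences R x - r * (x ^ suc i * ∏-differences R x))
        ≡⟨ ≡.trans (∑-- E _ _) (cong (λ t → ∑ E (λ x → x ^ suc (suc i) * ∏-differences R x) - t) (∑-*ˡ E r _)) ⟩
      ∑ E (λ x → x ^ suc (suc i) * ∏-differences R x) - r * ∑ E (λ x → x ^ suc i * ∏-differences R x)
        ≡⟨ cong₂ (λ a b → a - r * b) (vanish R (suc i) len′)
             (vanish R i (ℕₚ.≤-trans (ℕₚ.n≤1+n _) len′)) ⟩
      0# - r * 0#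
        ≡⟨ solve 1 (λ r → con (pos 0) :- r :* con (pos 0) := con (pos 0)) ≡.refl r ⟩
      0# ∎
      where
      len′ : suc (suc i) ℕ.+ length R ≤ length E
      len′ = ℕₚ.≤-trans (ℕₚ.≤-reflexive (cong suc (sym (ℕₚ.+-suc i (length R))))) len

  balanced : ∀ {E S : List F} → Unique E → Unique S → ∀ {d η} → η ≢ 0# →
    (∀ {y x} → y ∈ S → x ∈ E → (y - x) ^ d ≡ η) →
    2 ≤ length E → 2 ≤ length S → length S ℕ.* length E ≡ d → d ℕ.+ d ≤ p →
    (∀ k → 0 < k → k < d → ∑∑ S E (λ y x → (y - x) ^ k) ≡ 0#) →
    length E ≡ length S
  balanced {E} {S} E! S! {d} η≢0 roots 2≤E 2≤S S*E≡d d+d≤p differences-vanish with length E ℕₚ.≟ length S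
  ... | yes E≡S = E≡S
  ... | no E≢S = contradiction (proj₂ (Decomposition.all-power-sums-vanish E′! S′! η≢0 roots′ 2≤E′ 2≤S′ S′*E′≡d d+d≤p differences-vanish′
            E′≢S′ centred (suc (length E′)) ℕₚ.≤-refl)) (¬power-sums-vanish E′! 2≤E′)
    where
    open ≡-Reasoning
    t : F
    -- The mean of `E`. Subtracting it from both sets changes none of the differences.
    t = inv (ι (length E)) * ∑ E (λ x → x)
    E′ S′ : List F
    E′ = map (_- t) E
    S′ = map (_- t) S
    |E′| : length E′ ≡ length E
    |E′| = length-map _ E
    |S′| : length S′ ≡ length S
    |S′| = length-map _ S
    shift-injective : ∀ {x y} → x - t ≡ y - t → x ≡ y
    shift-injective {x} {y} eq = ≡.trans (solve 2 (λ x t → x := (x :- t) :+ t) ≡.refl x t)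
      (≡.trans (cong (_+ t) eq) (solve 2 (λ x t → (x :- t) :+ t := x) ≡.refl y t))
    E′! : Unique E′
    E′! = Uniqueₚ.map⁺ shift-injective E!
    S′! : Unique S′
    S′! = Uniqueₚ.map⁺ shift-injective S!
    difference : ∀ y x → (y - t) - (x - t) ≡ y - x
    difference y x = solve 3 (λ y x t → (y :- t) :- (x :- t) := y :- x) ≡.refl y x t
    roots′ : ∀ {y x} → y ∈ S′ → x ∈ E′ → (y - x) ^ d ≡ _
    roots′ y∈ x∈ with y , y∈S , ≡.refl ← ∈-map⁻ (_- t) y∈ | x , x∈E , ≡.refl ← ∈-map⁻ (_- t) x∈ =
      ≡.trans (cong (_^ d) (difference y x)) (roots y∈S x∈E)
    2≤E′ : 2 ≤ length E′
    2≤E′ = subst (2 ≤_) (sym |E′|) 2≤E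
    2≤S′ : 2 ≤ length S′
    2≤S′ = subst (2 ≤_) (sym |S′|) 2≤S
    S′*E′≡d : length S′ ℕ.* length E′ ≡ d
    S′*E′≡d = ≡.trans (cong₂ ℕ._*_ |S′| |E′|) S*E≡d
    E′≢S′ : length E′ ≢ length S′
    E′≢S′ eq = E≢S (≡.trans (sym |E′|) (≡.trans eq |S′|))
    differences-vanish′ : ∀ k → 0 < k → k < d → ∑∑ S′ E′ (λ y x → (y - x) ^ k) ≡ 0#
    differences-vanish′ k 0<k k<d = begin
      ∑ S′ (λ y → ∑ E′ (λ x → (y - x) ^ k))                 ≡⟨ ∑-map S (_- t) _ ⟩
      ∑ S (λ y → ∑ E′ (λ x → ((y - t) - x) ^ k))            ≡⟨ ∑-cong S (λ _ → ∑-map E (_- t) _) ⟩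
      ∑∑ S E (λ y x → ((y - t) - (x - t)) ^ k)              ≡⟨ ∑∑-cong S E (λ {y} {x} _ _ → cong (_^ k) (difference y x)) ⟩
      ∑∑ S E (λ y x → (y - x) ^ k)                          ≡⟨ differences-vanish k 0<k k<d ⟩
      0#                                                    ∎
    m≢0 : ι (length E) ≢ 0#
    m≢0 = ι≢0 (length E) (ℕₚ.<⇒≤ 2≤E) (ℕₚ.<-≤-trans (ℕₚ.m<m*n (length E) (length S) {{ℕ.>-nonZero (ℕₚ.<⇒≤ 2≤E)}} 2≤S)
      (ℕₚ.≤-trans (ℕₚ.≤-reflexive (≡.trans (ℕₚ.*-comm (length E) _) S*E≡d)) (ℕₚ.≤-trans (ℕₚ.m≤m+n d d) d+d≤p)))
    centred : powerSum E′ 1 ≡ 0#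
    centred = begin
      ∑ E′ (_^ 1)                                           ≡⟨ ∑-map E (_- t) (_^ 1) ⟩
      ∑ E (λ x → (x - t) * 1#)                              ≡⟨ ∑-cong E (λ {x} _ → solve 1 (λ x → x :* con (pos 1) := x) ≡.refl (x - t)) ⟩
      ∑ E (λ x → x - t)                                     ≡⟨ ∑-- E (λ x → x) (λ _ → t) ⟩
      ∑ E (λ x → x) - ∑ E (λ _ → t)                         ≡⟨ cong (λ u → ∑ E (λ x → x) - u) (∑-const E t) ⟩
      ∑ E (λ x → x) - ι (length E) * t                      ≡⟨ solve 3 (λ s m i → s :- m :* (i :* s) := (con (pos 1) :- m :* i) :* s) ≡.refl (∑ E (λ x → x)) (ι (length E)) (inv (ι (length E))) ⟩
      (1# - ι (length E) * inv (ι (length E))) * ∑ E (λ x → x)   ≡⟨ cong (_* ∑ E (λ x → x)) (x≡y⇒x-y≡0 (sym (*-inv m≢0))) ⟩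
      0# * ∑ E (λ x → x)                                    ≡⟨ zeroˡ _ ⟩
      0#                                                    ∎

  -- Multiplicative subgroups and their additive decompositions

  ∏ : List F → F
  ∏ []       = 1#
  ∏ (x ∷ xs) = x * ∏ xs

  ∏-↭ : ∀ {xs ys} → xs ↭ ys → ∏ xs ≡ ∏ ys
  ∏-↭ refl = ≡.refl
  ∏-↭ (prep x xs↭ys) = cong (x *_) (∏-↭ xs↭ys)
  ∏-↭ (swap {xs} {ys} x y xs↭ys) = ≡.trans (cong (λ t → x * (y * t)) (∏-↭ xs↭ys))
    (solve 3 (λ a b c → a :* (b :* c) := b :* (a :* c)) ≡.refl x y (∏ ys))
  ∏-↭ (trans xs↭ys ys↭zs) = ≡.trans (∏-↭ xs↭ys) (∏-↭ ys↭zs)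

  ∏-map-* : ∀ x ys → ∏ (map (x *_) ys) ≡ x ^ length ys * ∏ ys
  ∏-map-* x [] = sym (*-identityˡ _)
  ∏-map-* x (y ∷ ys) = ≡.trans (cong ((x * y) *_) (∏-map-* x ys))
    (solve 4 (λ x y q r → (x :* y) :* (q :* r) := (x :* q) :* (y :* r)) ≡.refl x y (x ^ length ys) (∏ ys))

  ∏≢0 : ∀ {ys} → All (_≢ 0#) ys → ∏ ys ≢ 0#
  ∏≢0 []            = 1≢0
  ∏≢0 (y≢0 ∷ ys≢0)  = xy≢0 y≢0 (∏≢0 ys≢0)

  +-cancelʳ : ∀ {x y} z → x + z ≡ y + z → x ≡ y
  +-cancelʳ {x} {y} z eq = ≡.trans (solve 2 (λ x z → x := (x :+ z) :- z) ≡.refl x z)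
    (≡.trans (cong (_- z) eq) (solve 2 (λ x z → (x :+ z) :- z := x) ≡.refl y z))

  module Subgroup {G : List F} (G! : Unique G) (0∉G : 0# ∉ G) (*-closed : ∀ {x y} → x ∈ G → y ∈ G → x * y ∈ G)
    (0<|G| : 0 < length G) (2|G|≤p : length G ℕ.+ length G ≤ p) where

    private
      d : ℕ
      d = length G

    ∈⇒≢0 : ∀ {x} → x ∈ G → x ≢ 0#
    ∈⇒≢0 x∈G ≡.refl = 0∉G x∈G

    G↭xG : ∀ {x} → x ∈ G → G ↭ map (x *_) G
    G↭xG {x} x∈G = Unique∧⊆∧length≤⇒↭ (Uniqueₚ.map⁺ (*-cancelˡ (∈⇒≢0 x∈G)) G!) xG⊆G (ℕₚ.≤-reflexive (sym (length-map (x *_) G)))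
      where
      xG⊆G : ∀ {y} → y ∈ map (x *_) G → y ∈ G
      xG⊆G y∈ with z , z∈G , ≡.refl ← ∈-map⁻ (x *_) y∈ = *-closed x∈G z∈G

    lagrange : ∀ {x} → x ∈ G → x ^ d ≡ 1#
    lagrange {x} x∈G = *-cancelˡ (∏≢0 (All.tabulate ∈⇒≢0)) (begin
      ∏ G * x ^ d              ≡⟨ *-comm _ _ ⟩
      x ^ d * ∏ G              ≡⟨ ∏-map-* x G ⟨
      ∏ (map (x *_) G)         ≡⟨ ∏-↭ (G↭xG x∈G) ⟨
      ∏ G                      ≡⟨ *-identityʳ _ ⟨
      ∏ G * 1#                 ∎)
      where
      open ≡-Reasoning

    -- If some `g` in `G` has `g ^ k ≠ 1#`, then multiplication by `g` permutes `G` and multiplies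
    -- the power sum by `g ^ k`, so the sum is zero. Otherwise y ^ k = 1 would have too many
    -- solutions.
    powerSum-G : ∀ k → 0 < k → k < d → powerSum G k ≡ 0#
    powerSum-G k 0<k k<d with All.all? (λ g → (g ^ k) ≟ 1#) G
    ... | yes g^k≡1 = contradiction k<d (ℕₚ.≤⇒≯ (ℕₚ.≤-trans (ℕₚ.≤-reflexive (sym (ℕₚ.*-identityʳ d)))
            -- For `E = 0# ∷ []` Stepanov's bound is the bound `k` on the number of solutions of y ^
            -- k = 1.
            (length*length≤ {E = 0# ∷ []} ([] ∷ []) G! 0<k 1≢0
              (λ { {y} y∈G (here ≡.refl) → ≡.trans (cong (_^ k) (solve 1 (λ y → y :- con (pos 0) := y) ≡.refl y)) (All.lookup g^k≡1 y∈G) })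
              0<k (ℕₚ.≤-trans (ℕₚ.≤-reflexive (ℕₚ.+-comm k 1)) (ℕₚ.≤-trans k<d (ℕₚ.≤-trans (ℕₚ.m≤m+n d d) 2|G|≤p))))))
    ... | no ¬all with g , g∈G , g^k≢1 ← find (Allₚ.¬All⇒Any¬ (λ g → (g ^ k) ≟ 1#) G ¬all) =
      xy≡0⇒y≡0 (x≢y⇒x-y≢0 g^k≢1) (≡.trans (solve 2 (λ a b → (a :- con (pos 1)) :* b := a :* b :- b) ≡.refl (g ^ k) (powerSum G k)) (x≡y⇒x-y≡0 (begin
        g ^ k * powerSum G k           ≡⟨ ∑-*ˡ G (g ^ k) (_^ k) ⟨
        ∑ G (λ x → g ^ k * x ^ k)      ≡⟨ ∑-cong G (λ {x} _ → ^-distrib-* g x k) ⟨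
        ∑ G (λ x → (g * x) ^ k)        ≡⟨ ∑-map G (g *_) (_^ k) ⟨
        powerSum (map (g *_) G) k      ≡⟨ ∑-↭ (G↭xG g∈G) (_^ k) ⟨
        powerSum G k                   ∎)))
      where open ≡-Reasoning

    module _ {A T : List F} (A! : Unique A) (T! : Unique T) (2≤A : 2 ≤ length A) (2≤T : 2 ≤ length T)
      (sum∈ : ∀ {t a} → t ∈ T → a ∈ A → t + a ∈ G) (cover : ∀ {g} → g ∈ G → ∃ λ t → ∃ λ a → t ∈ T × a ∈ A × g ≡ t + a) where

      private
        -- Negating `A` turns the sums `t + a` into the differences `t - e` that Stepanov's method
        -- handles.
        E : List F
        E = map -_ A

        |E| : length E ≡ length A
        |E| = length-map -_ A

        t-[-a] : ∀ t a → t - (- a) ≡ t + a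
        t-[-a] = solve 2 (λ t a → t :- :- a := t :+ a) ≡.refl

        E! : Unique E
        E! = Uniqueₚ.map⁺ (λ {x} {y} eq → ≡.trans (sym (-‿involutive x)) (≡.trans (cong -_ eq) (-‿involutive y))) A!

        roots : ∀ {t e} → t ∈ T → e ∈ E → (t - e) ^ d ≡ 1#
        roots {t} t∈T e∈E with a , a∈A , ≡.refl ← ∈-map⁻ -_ e∈E = ≡.trans (cong (_^ d) (t-[-a] t a)) (lagrange (sum∈ t∈T a∈A))

        A≤G : length A ≤ d
        A≤G = go T 2≤T (λ t∈ → t∈)
          where
          go : ∀ X → 2 ≤ length X → (∀ {t} → t ∈ X → t ∈ T) → length A ≤ d
          go (t ∷ X) _ X⊆T = subst (_≤ d) (length-map (t +_) A) (Unique∧⊆⇒length≤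
            (Uniqueₚ.map⁺ (λ {x} {y} eq → +-cancelʳ t (≡.trans (+-comm x t) (≡.trans eq (+-comm t y)))) A!) t+A⊆G)
            where
            t+A⊆G : ∀ {g} → g ∈ map (t +_) A → g ∈ G
            t+A⊆G g∈ with a , a∈A , ≡.refl ← ∈-map⁻ (t +_) g∈ = sum∈ (X⊆T (here ≡.refl)) a∈A

        T+A : List F
        T+A = cartesianProductWith _+_ T A

        G⊆T+A : ∀ {g} → g ∈ G → g ∈ T+A
        G⊆T+A g∈G with t , a , t∈T , a∈A , ≡.refl ← cover g∈G = ∈-cartesianProductWith⁺ _+_ t∈T a∈A

        |T||A|≤d : length T ℕ.* length A ≤ d
        |T||A|≤d = subst (λ k → length T ℕ.* k ≤ d) |E| (length*length≤ E! T! 0<|G| 1≢0 roots (subst (_≤ d) (sym |E|) A≤G)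
          (ℕₚ.≤-trans (ℕₚ.+-monoʳ-≤ d (subst (_≤ d) (sym |E|) A≤G)) 2|G|≤p))

      -- Stepanov's bound from above, the covering of `G` by sums from below.
      |T||A|≡|G| : length T ℕ.* length A ≡ length G
      |T||A|≡|G| = ℕₚ.≤-antisym |T||A|≤d
        (ℕₚ.≤-trans (Unique∧⊆⇒length≤ G! G⊆T+A) (ℕₚ.≤-reflexive (length-cartesianProductWith _+_ T A)))

      |A|≡|T| : length A ≡ length T
      |A|≡|T| = ≡.trans (sym |E|) (balanced E! T! 1≢0 roots (subst (2 ≤_) (sym |E|) 2≤A) 2≤T
        (≡.trans (cong (length T ℕ.*_) |E|) |T||A|≡|G|) 2|G|≤p (λ k 0<k k<d → begin
          ∑ T (λ t → ∑ E (λ e → (t - e) ^ k))        ≡⟨ ∑-cong T (λ {t} _ → ≡.trans (∑-map A -_ _) (∑-cong A (λ {a} _ → cong (_^ k) (t-[-a] t a)))) ⟩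
          ∑ T (λ t → ∑ A (λ a → (t + a) ^ k))        ≡⟨ ∑-cartesian _+_ T A (_^ k) ⟨
          -- The equality of sizes makes the list of all sums a permutation of `G`, without
          -- repetitions.
          powerSum T+A k                             ≡⟨ ∑-↭ (Unique∧⊆∧length≤⇒↭ G! G⊆T+A
                                                          (ℕₚ.≤-reflexive (≡.trans (length-cartesianProductWith _+_ T A) |T||A|≡|G|))) (_^ k) ⟩
          powerSum G k                               ≡⟨ powerSum-G k 0<k k<d ⟩
          0#                                         ∎))
        where open ≡-Reasoning

    infixl 6 _⊞_
    _⊞_ : List F → List F → List F
    B ⊞ C = deduplicate _≟_ (cartesianProductWith _+_ B C)

    ∈-⊞⁺ : ∀ {B C b c} → b ∈ B → c ∈ C → b + c ∈ B ⊞ C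
    ∈-⊞⁺ b∈B c∈C = ∈-deduplicate⁺ _≟_ (∈-cartesianProductWith⁺ _+_ b∈B c∈C)

    ∈-⊞⁻ : ∀ B C {t} → t ∈ B ⊞ C → ∃ λ b → ∃ λ c → b ∈ B × c ∈ C × t ≡ b + c
    ∈-⊞⁻ B C t∈ = ∈-cartesianProductWith⁻ _+_ B C (∈-deduplicate⁻ _≟_ (cartesianProductWith _+_ B C) t∈)

    ⊞-! : ∀ B C → Unique (B ⊞ C)
    ⊞-! B C = DecUniqueₚ.deduplicate-! _≟_ (cartesianProductWith _+_ B C)

    B+c-! : ∀ {B} → Unique B → ∀ c → Unique (map (_+ c) B)
    B+c-! B! c = Uniqueₚ.map⁺ (+-cancelʳ c) B!

    B+c⊆B⊞C : ∀ {B C c} → c ∈ C → ∀ {t} → t ∈ map (_+ c) B → t ∈ B ⊞ C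
    B+c⊆B⊞C {c = c} c∈C t∈ with b , b∈B , ≡.refl ← ∈-map⁻ (_+ c) t∈ = ∈-⊞⁺ b∈B c∈C

    |B|≤|B⊞C| : ∀ {B C} → Unique B → 2 ≤ length C → length B ≤ length (B ⊞ C)
    |B|≤|B⊞C| {B} {c ∷ C} B! _ = subst (_≤ length (B ⊞ (c ∷ C))) (length-map (_+ c) B)
      (Unique∧⊆⇒length≤ (B+c-! B! c) (B+c⊆B⊞C (here ≡.refl)))

    -- If |B + C| = |B|, then B + c = B + C for every c in C, and summing the elements determines c.
    |B⊞C|≢|B| : ∀ {B C} → Unique B → Unique C → 2 ≤ length C → ι (length B) ≢ 0# → length (B ⊞ C) ≢ length B
    |B⊞C|≢|B| {B} {c ∷ c′ ∷ C} B! ((c≢c′ ∷ _) ∷ _) _ |B|≢0 eq =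
      c≢c′ (*-cancelˡ |B|≢0 (+-cancelʳ (∑ B (λ b → b)) (≡.trans (sym (total (here ≡.refl))) (total (there (here ≡.refl))))))
      where
      open ≡-Reasoning
      total : ∀ {x} → x ∈ c ∷ c′ ∷ C → ∑ (B ⊞ (c ∷ c′ ∷ C)) (λ t → t) ≡ ι (length B) * x + ∑ B (λ b → b)
      total {x} x∈ = begin
        ∑ (B ⊞ (c ∷ c′ ∷ C)) (λ t → t)        ≡⟨ ∑-↭ (Unique∧⊆∧length≤⇒↭ (B+c-! B! x) (B+c⊆B⊞C x∈) (ℕₚ.≤-reflexive (≡.trans eq (sym (length-map (_+ x) B))))) (λ t → t) ⟩
        ∑ (map (_+ x) B) (λ t → t)            ≡⟨ ∑-map B (_+ x) (λ t → t) ⟩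
        ∑ B (λ b → b + x)                     ≡⟨ ∑-+ B (λ b → b) (λ _ → x) ⟩
        ∑ B (λ b → b) + ∑ B (λ _ → x)         ≡⟨ cong (∑ B (λ b → b) +_) (∑-const B x) ⟩
        ∑ B (λ b → b) + ι (length B) * x      ≡⟨ +-comm _ _ ⟩
        ι (length B) * x + ∑ B (λ b → b)      ∎
    |B⊞C|≢|B| {C = c ∷ []} _ _ (s≤s ()) _ _

    private
      square-injective : ∀ {m n} → m ℕ.* m ≡ n ℕ.* n → m ≡ n
      square-injective {m} {n} eq with ℕₚ.<-cmp m n
      ... | tri< m<n _ _ = contradiction eq (ℕₚ.<⇒≢ (ℕₚ.*-mono-< m<n m<n))
      ... | tri≈ _ m≡n _ = m≡n
      ... | tri> _ _ n<m = contradiction (sym eq) (ℕₚ.<⇒≢ (ℕₚ.*-mono-< n<m n<m))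

      summand : ∀ {A B C} → Unique A → Unique B → 2 ≤ length A → 2 ≤ length B → 2 ≤ length C →
        (∀ {a b c} → a ∈ A → b ∈ B → c ∈ C → (b + c) + a ∈ G) →
        (∀ {g} → g ∈ G → ∃ λ a → ∃ λ b → ∃ λ c → a ∈ A × b ∈ B × c ∈ C × g ≡ (b + c) + a) →
        length A ≡ length (B ⊞ C) × length (B ⊞ C) ℕ.* length A ≡ length G
      summand {A} {B} {C} A! B! 2≤A 2≤B 2≤C sum∈ cover =
        |A|≡|T| A! (⊞-! B C) 2≤A 2≤B⊞C sum∈′ cover′ , |T||A|≡|G| A! (⊞-! B C) 2≤A 2≤B⊞C sum∈′ cover′
        where
        2≤B⊞C : 2 ≤ length (B ⊞ C)
        2≤B⊞C = ℕₚ.≤-trans 2≤B (|B|≤|B⊞C| B! 2≤C)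
        sum∈′ : ∀ {t a} → t ∈ B ⊞ C → a ∈ A → t + a ∈ G
        sum∈′ t∈ a∈A with b , c , b∈B , c∈C , ≡.refl ← ∈-⊞⁻ B C t∈ = sum∈ a∈A b∈B c∈C
        cover′ : ∀ {g} → g ∈ G → ∃ λ t → ∃ λ a → t ∈ B ⊞ C × a ∈ A × g ≡ t + a
        cover′ g∈G with a , b , c , a∈A , b∈B , c∈C , eq ← cover g∈G = b + c , a , ∈-⊞⁺ b∈B c∈C , a∈A , eq

    no-ternary-decomposition : ∀ {A B C} → Unique A → Unique B → Unique C → 2 ≤ length A → 2 ≤ length B → 2 ≤ length C →
      (∀ {a b c} → a ∈ A → b ∈ B → c ∈ C → (a + b) + c ∈ G) →
      ¬ (∀ {g} → g ∈ G → ∃ λ a → ∃ λ b → ∃ λ c → a ∈ A × b ∈ B × c ∈ C × g ≡ (a + b) + c)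
    no-ternary-decomposition {A} {B} {C} A! B! C! 2≤A 2≤B 2≤C sum∈ cover =
      |B⊞C|≢|B| B! C! 2≤C |B|≢0 (≡.trans (sym |A|≡) |A|≡|B|)
      where
      |A| : length A ≡ length (B ⊞ C) × length (B ⊞ C) ℕ.* length A ≡ length G
      |A| = summand A! B! 2≤A 2≤B 2≤C
        (λ {a} {b} {c} a∈ b∈ c∈ → subst (_∈ G) (solve 3 (λ a b c → (a :+ b) :+ c := (b :+ c) :+ a) ≡.refl a b c) (sum∈ a∈ b∈ c∈))
        (λ g∈ → let a , b , c , a∈ , b∈ , c∈ , eq = cover g∈ in
          a , b , c , a∈ , b∈ , c∈ , ≡.trans eq (solve 3 (λ a b c → (a :+ b) :+ c := (b :+ c) :+ a) ≡.refl a b c))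
      |B| : length B ≡ length (A ⊞ C) × length (A ⊞ C) ℕ.* length B ≡ length G
      |B| = summand B! A! 2≤B 2≤A 2≤C
        (λ {b} {a} {c} b∈ a∈ c∈ → subst (_∈ G) (solve 3 (λ a b c → (a :+ b) :+ c := (a :+ c) :+ b) ≡.refl a b c) (sum∈ a∈ b∈ c∈))
        (λ g∈ → let a , b , c , a∈ , b∈ , c∈ , eq = cover g∈ in
          b , a , c , b∈ , a∈ , c∈ , ≡.trans eq (solve 3 (λ a b c → (a :+ b) :+ c := (a :+ c) :+ b) ≡.refl a b c))
      |A|≡ : length A ≡ length (B ⊞ C)
      |A|≡ = proj₁ |A|
      |A|²≡|G| : length A ℕ.* length A ≡ length G
      |A|²≡|G| = ≡.trans (cong (ℕ._* length A) (proj₁ |A|)) (proj₂ |A|)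
      |B|²≡|G| : length B ℕ.* length B ≡ length G
      |B|²≡|G| = ≡.trans (cong (ℕ._* length B) (proj₁ |B|)) (proj₂ |B|)
      |A|≡|B| : length A ≡ length B
      |A|≡|B| = square-injective (≡.trans |A|²≡|G| (sym |B|²≡|G|))
      |B|≢0 : ι (length B) ≢ 0#
      |B|≢0 = ι≢0 (length B) (ℕₚ.<⇒≤ 2≤B) (ℕₚ.<-≤-trans (ℕₚ.m<m*n (length B) (length B) {{ℕ.>-nonZero (ℕₚ.<⇒≤ 2≤B)}} 2≤B)
        (ℕₚ.≤-trans (ℕₚ.≤-reflexive |B|²≡|G|) (ℕₚ.≤-trans (ℕₚ.m≤m+n d d) 2|G|≤p)))

-- The integers modulo a prime as a field

module PrimeField {p : ℕ} .{{_ : NonZero p}} (p-prime : Prime p) where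

  private
    [_] : ℕ → Fin p
    [ k ] = k mod p

    toℕ-[] : ∀ k → toℕ [ k ] ≡ k % p
    toℕ-[] k = Finₚ.toℕ-fromℕ< (m%n<n k p)

    []-toℕ : ∀ x → [ toℕ x ] ≡ x
    []-toℕ x = Finₚ.toℕ-injective (≡.trans (toℕ-[] (toℕ x)) (m<n⇒m%n≡m (Finₚ.toℕ<n x)))

    []-cong : ∀ {k l} → k % p ≡ l % p → [ k ] ≡ [ l ]
    []-cong {k} {l} eq = Finₚ.toℕ-injective (≡.trans (toℕ-[] k) (≡.trans eq (sym (toℕ-[] l))))

    []-+ : ∀ k l → [ k ] +F [ l ] ≡ [ k ℕ.+ l ]
    []-+ k l = ≡.trans (cong₂ (λ a b → [ a ℕ.+ b ]) (toℕ-[] k) (toℕ-[] l)) ([]-cong (sym (%-distribˡ-+ k l p)))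

    []-* : ∀ k l → [ k ] *F [ l ] ≡ [ k ℕ.* l ]
    []-* k l = ≡.trans (cong₂ (λ a b → [ a ℕ.* b ]) (toℕ-[] k) (toℕ-[] l)) ([]-cong (sym (%-distribˡ-* k l p)))

    -- Reduces each ring law to residues of natural numbers, where it follows from the same law in
    -- ℕ.
    []-surjective : ∀ {P : Fin p → Set} → (∀ k → P [ k ]) → ∀ x → P x
    []-surjective {P} P[] x = subst P ([]-toℕ x) (P[] (toℕ x))

  -F_ : Fin p → Fin p
  -F x = [ p ∸ toℕ x ]

  private
    +F-assoc : Associative _≡_ _+F_
    +F-assoc = []-surjective λ k → []-surjective λ l → []-surjective λ m → begin
      ([ k ] +F [ l ]) +F [ m ]      ≡⟨ ≡.trans (cong (_+F [ m ]) ([]-+ k l)) ([]-+ (k ℕ.+ l) m) ⟩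
      [ k ℕ.+ l ℕ.+ m ]              ≡⟨ cong [_] (ℕₚ.+-assoc k l m) ⟩
      [ k ℕ.+ (l ℕ.+ m) ]            ≡⟨ ≡.trans (cong ([ k ] +F_) ([]-+ l m)) ([]-+ k (l ℕ.+ m)) ⟨
      [ k ] +F ([ l ] +F [ m ])      ∎
      where open ≡-Reasoning

    *F-assoc : Associative _≡_ _*F_
    *F-assoc = []-surjective λ k → []-surjective λ l → []-surjective λ m → begin
      ([ k ] *F [ l ]) *F [ m ]      ≡⟨ ≡.trans (cong (_*F [ m ]) ([]-* k l)) ([]-* (k ℕ.* l) m) ⟩
      [ k ℕ.* l ℕ.* m ]              ≡⟨ cong [_] (ℕₚ.*-assoc k l m) ⟩
      [ k ℕ.* (l ℕ.* m) ]            ≡⟨ ≡.trans (cong ([ k ] *F_) ([]-* l m)) ([]-* k (l ℕ.* m)) ⟨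
      [ k ] *F ([ l ] *F [ m ])      ∎
      where open ≡-Reasoning

    +F-comm : Commutative _≡_ _+F_
    +F-comm x y = cong [_] (ℕₚ.+-comm (toℕ x) (toℕ y))

    *F-comm : Commutative _≡_ _*F_
    *F-comm x y = cong [_] (ℕₚ.*-comm (toℕ x) (toℕ y))

    +F-identityˡ : LeftIdentity _≡_ 0F _+F_
    +F-identityˡ = []-surjective ([]-+ 0)

    *F-identityˡ : LeftIdentity _≡_ 1F _*F_
    *F-identityˡ = []-surjective λ k → ≡.trans ([]-* 1 k) (cong [_] (ℕₚ.*-identityˡ k))

    *F-distribˡ-+F : _DistributesOverˡ_ _≡_ _*F_ _+F_
    *F-distribˡ-+F = []-surjective λ k → []-surjective λ l → []-surjective λ m → begin
      [ k ] *F ([ l ] +F [ m ])              ≡⟨ ≡.trans (cong ([ k ] *F_) ([]-+ l m)) ([]-* k (l ℕ.+ m)) ⟩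
      [ k ℕ.* (l ℕ.+ m) ]                    ≡⟨ cong [_] (ℕₚ.*-distribˡ-+ k l m) ⟩
      [ k ℕ.* l ℕ.+ k ℕ.* m ]                ≡⟨ []-+ (k ℕ.* l) (k ℕ.* m) ⟨
      [ k ℕ.* l ] +F [ k ℕ.* m ]             ≡⟨ cong₂ _+F_ ([]-* k l) ([]-* k m) ⟨
      ([ k ] *F [ l ]) +F ([ k ] *F [ m ])   ∎
      where open ≡-Reasoning

    -F-inverseʳ : ∀ x → x +F (-F x) ≡ 0F
    -F-inverseʳ x = begin
      x +F [ p ∸ toℕ x ]                ≡⟨ cong (_+F [ p ∸ toℕ x ]) ([]-toℕ x) ⟨
      [ toℕ x ] +F [ p ∸ toℕ x ]        ≡⟨ []-+ (toℕ x) (p ∸ toℕ x) ⟩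
      [ toℕ x ℕ.+ (p ∸ toℕ x) ]         ≡⟨ cong [_] (ℕₚ.m+[n∸m]≡n (ℕₚ.<⇒≤ (Finₚ.toℕ<n x))) ⟩
      [ p ]                             ≡⟨ []-cong (≡.trans (n%n≡0 p) (sym (m*n%n≡0 0 p))) ⟩
      0F                                ∎
      where open ≡-Reasoning

  isCommutativeRing-F : IsCommutativeRing _≡_ _+F_ _*F_ -F_ 0F 1F
  isCommutativeRing-F = record
    { isRing = record
      { +-isAbelianGroup = record
        { isGroup = record
          { isMonoid = record
            { isSemigroup = record
              { isMagma = record { isEquivalence = ≡.isEquivalence ; ∙-cong = cong₂ _+F_ }
              ; assoc = +F-assoc
              }
            ; identity = +F-identityˡ , λ x → ≡.trans (+F-comm x 0F) (+F-identityˡ x)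
            }
          ; inverse = (λ x → ≡.trans (+F-comm (-F x) x) (-F-inverseʳ x)) , -F-inverseʳ
          ; ⁻¹-cong = cong -F_
          }
        ; comm = +F-comm
        }
      ; *-cong = cong₂ _*F_
      ; *-assoc = *F-assoc
      ; *-identity = *F-identityˡ , λ x → ≡.trans (*F-comm x 1F) (*F-identityˡ x)
      ; distrib = *F-distribˡ-+F , λ z x y → ≡.trans (*F-comm (x +F y) z)
          (≡.trans (*F-distribˡ-+F z x y) (cong₂ _+F_ (*F-comm z x) (*F-comm z y)))
      }
    ; *-comm = *F-comm
    }

  private
    module R = Ring isCommutativeRing-F

    1<p : 1 < p
    1<p = ℕ.nonTrivial⇒n>1 p {{prime⇒nonTrivial p-prime}}

    ι≡[] : ∀ k → R.ι k ≡ [ k ]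
    ι≡[] zero = ≡.refl
    ι≡[] (suc k) = ≡.trans (R.ι-suc k) (≡.trans (cong (1F +F_) (ι≡[] k)) ([]-+ 1 k))

    [k]≢0 : ∀ k → 0 < k → k < p → [ k ] ≢ 0F
    [k]≢0 k 0<k k<p eq = contradiction (begin
      0              ≡⟨ m<n⇒m%n≡m {n = p} (ℕₚ.<-trans 0<k k<p) ⟨
      0 % p          ≡⟨ toℕ-[] 0 ⟨
      toℕ (0 mod p)  ≡⟨ cong toℕ eq ⟨
      toℕ [ k ]      ≡⟨ toℕ-[] k ⟩
      k % p          ≡⟨ m<n⇒m%n≡m k<p ⟩
      k              ∎) (ℕₚ.<⇒≢ 0<k)
      where open ≡-Reasoning

    inverse-F : ∀ x → x ≢ 0F → ∃ λ y → x *F y ≡ 1F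
    inverse-F x x≢0 with coprime-Bézout (prime⇒coprime p-prime {{x-nonZero}} (Finₚ.toℕ<n x))
      where
      x-nonZero : NonZero (toℕ x)
      x-nonZero = ℕ.≢-nonZero λ eq → x≢0 (≡.trans (sym ([]-toℕ x)) (cong [_] eq))
    ... | Bézout.-+ a b eq = [ b ] , (begin
      x *F [ b ]               ≡⟨ *F-comm x [ b ] ⟩
      [ b ] *F x               ≡⟨ cong ([ b ] *F_) ([]-toℕ x) ⟨
      [ b ] *F [ toℕ x ]       ≡⟨ []-* b (toℕ x) ⟩
      [ b ℕ.* toℕ x ]          ≡⟨ cong [_] eq ⟨
      [ 1 ℕ.+ a ℕ.* p ]        ≡⟨ []-+ 1 (a ℕ.* p) ⟨
      1F +F [ a ℕ.* p ]        ≡⟨ cong (1F +F_) ([]-cong (≡.trans (m*n%n≡0 a p) (sym (m*n%n≡0 0 p)))) ⟩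
      1F +F 0F                 ≡⟨ R.+-identityʳ 1F ⟩
      1F                       ∎)
      where open ≡-Reasoning
    -- Here 1 + b x is a multiple of `p`, so the inverse is the negative of `b`.
    ... | Bézout.+- a b eq = -F [ b ] , R.x-y≡0⇒x≡y (begin
      (x *F (-F [ b ])) +F (-F 1F)         ≡⟨ R.solve 2 (λ x b → x R.:* (R.:- b) R.:- R.con (pos 1) R.:= R.:- (R.con (pos 1) R.:+ b R.:* x)) ≡.refl x [ b ] ⟩
      -F (1F +F ([ b ] *F x))              ≡⟨ cong (λ t → -F (1F +F ([ b ] *F t))) ([]-toℕ x) ⟨
      -F (1F +F ([ b ] *F [ toℕ x ]))      ≡⟨ cong -F_ (≡.trans (cong (1F +F_) ([]-* b (toℕ x))) ([]-+ 1 (b ℕ.* toℕ x))) ⟩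
      -F [ 1 ℕ.+ b ℕ.* toℕ x ]             ≡⟨ cong (λ k → -F [ k ]) eq ⟩
      -F [ a ℕ.* p ]                       ≡⟨ cong -F_ ([]-cong (≡.trans (m*n%n≡0 a p) (sym (m*n%n≡0 0 p)))) ⟩
      -F 0F                                ≡⟨ R.-0#≈0# ⟩
      0F                                   ∎)
      where open ≡-Reasoning

  isField-F : IsFieldOfCharacteristic≥ p _+F_ _*F_ -F_ 0F 1F
  isField-F = record
    { isCommutativeRing = isCommutativeRing-F
    ; _≟_               = Fin._≟_
    ; inverse           = inverse-F
    ; ι≢0               = λ k 0<k k<p eq → [k]≢0 k 0<k k<p (≡.trans (sym (ι≡[] k)) eq)
    }

  open Field isField-F 1<p public

-- Subsets as lists without repetition, and the theorem

elements : ∀ {n} → Subset n → List (Fin n)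
elements []          = []
elements (true ∷ G)  = Fin.zero ∷ map Fin.suc (elements G)
elements (false ∷ G) = map Fin.suc (elements G)

length-elements : ∀ {n} (G : Subset n) → length (elements G) ≡ ∣ G ∣
length-elements []          = ≡.refl
length-elements (true ∷ G)  = cong suc (≡.trans (length-map Fin.suc (elements G)) (length-elements G))
length-elements (false ∷ G) = ≡.trans (length-map Fin.suc (elements G)) (length-elements G)

elements-! : ∀ {n} (G : Subset n) → Unique (elements G)
elements-! []          = []
elements-! (true ∷ G)  = Allₚ.map⁺ (All.universal (λ _ ()) (elements G)) ∷ Uniqueₚ.map⁺ Finₚ.suc-injective (elements-! G)
elements-! (false ∷ G) = Uniqueₚ.map⁺ Finₚ.suc-injective (elements-! G)

∈-elements⁺ : ∀ {n} {x : Fin n} {G : Subset n} → x Subset.∈ G → x ∈ elements G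
∈-elements⁺ Vec.here = here ≡.refl
∈-elements⁺ {G = true ∷ G}  (Vec.there x∈G) = there (∈-map⁺ Fin.suc (∈-elements⁺ x∈G))
∈-elements⁺ {G = false ∷ G} (Vec.there x∈G) = ∈-map⁺ Fin.suc (∈-elements⁺ x∈G)

∈-elements⁻ : ∀ {n} {x : Fin n} (G : Subset n) → x ∈ elements G → x Subset.∈ G
∈-elements⁻ (true ∷ G) (here ≡.refl) = Vec.here
∈-elements⁻ (true ∷ G) (there x∈) with y , y∈G , ≡.refl ← ∈-map⁻ Fin.suc x∈ = Vec.there (∈-elements⁻ G y∈G)
∈-elements⁻ (false ∷ G) x∈ with y , y∈G , ≡.refl ← ∈-map⁻ Fin.suc x∈ = Vec.there (∈-elements⁻ G y∈G)

theorem1p5 : ∃ λ (M : ℕ) → 0 < M ×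
    ((p : ℕ) .{{_ : NonZero p}} → Prime p →
    (G : Subset p) → IsSubgroupOfUnits G → IsProperInUnits G → M < ∣ G ∣ →
    ¬ (∃ λ (A : Subset p) → ∃ λ (B : Subset p) → ∃ λ (C : Subset p) →
    2 ≤ ∣ A ∣ × 2 ≤ ∣ B ∣ × 2 ≤ ∣ C ∣ × IsSumset3 G A B C))
-- `M = 1` suffices because all estimates on the way are exact, with no asymptotic loss.
theorem1p5 = 1 , s≤s z≤n , λ p p-prime G isSubgroup (x , x≢0 , x∉G) 1<|G| (A , B , C , 2≤A , 2≤B , 2≤C , isSumset) →
  let
    open PrimeField p-prime
    open IsSubgroupOfUnits isSubgroup
    g = elements G

    x*-injective : ∀ {y z} → x *F y ≡ x *F z → y ≡ z
    x*-injective = *-cancelˡ x≢0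

    -- A common element `y = x z` would give x = y z⁻¹, an element of `G`.
    disjoint : ∀ {y} → ¬ (y ∈ g × y ∈ map (x *F_) g)
    disjoint (y∈g , y∈xg) =
      let z , z∈g , y≡xz = ∈-map⁻ (x *F_) y∈xg
          w , w∈G , zw≡1 = inv∈ z (∈-elements⁻ G z∈g)
          x≡yw = ≡.trans (≡.trans (sym (*-identityʳ x)) (cong (x *F_) (sym zw≡1)))
                   (≡.trans (sym (*-assoc x z w)) (cong (_*F w) (sym y≡xz)))
      in x∉G (subst (Subset._∈ G) (sym x≡yw) (mul∈ _ w (∈-elements⁻ G y∈g) w∈G))

    -- `G` and its coset by `x` are disjoint and of equal size inside a field of `p` elements.
    2|G|≤p : length g ℕ.+ length g ≤ p
    2|G|≤p = ℕₚ.≤-trans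
      (ℕₚ.≤-reflexive (≡.trans (cong (length g ℕ.+_) (sym (length-map (x *F_) g))) (sym (length-++ g))))
      (ℕₚ.≤-trans (Unique∧⊆⇒length≤ (Uniqueₚ.++⁺ (elements-! G) (Uniqueₚ.map⁺ x*-injective (elements-! G)) disjoint) (λ {y} _ → ∈-allFin y))
        (ℕₚ.≤-reflexive (length-tabulate {n = p} (λ i → i))))
  in
  Subgroup.no-ternary-decomposition (elements-! G) (λ 0∈g → zero∉ (∈-elements⁻ G 0∈g))
    (λ y∈ z∈ → ∈-elements⁺ (mul∈ _ _ (∈-elements⁻ G y∈) (∈-elements⁻ G z∈)))
    (subst (0 <_) (sym (length-elements G)) (ℕₚ.<⇒≤ 1<|G|)) 2|G|≤p
    (elements-! A) (elements-! B) (elements-! C)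
    (subst (2 ≤_) (sym (length-elements A)) 2≤A) (subst (2 ≤_) (sym (length-elements B)) 2≤B) (subst (2 ≤_) (sym (length-elements C)) 2≤C)
    (λ {a} {b} {c} a∈ b∈ c∈ → ∈-elements⁺ (Equivalence.from (isSumset ((a +F b) +F c))
      (a , b , c , ∈-elements⁻ A a∈ , ∈-elements⁻ B b∈ , ∈-elements⁻ C c∈ , ≡.refl)))
    (λ {y} y∈g → let a , b , c , a∈A , b∈B , c∈C , eq = Equivalence.to (isSumset y) (∈-elements⁻ G y∈g) in
      a , b , c , ∈-elements⁺ a∈A , ∈-elements⁺ b∈B , ∈-elements⁺ c∈C , eq)
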